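{- Let $n\geq 85$. Then every edge coloring of $K_n^4$ with $3$ colors contains a monochromatic Hamiltonian Berge-cycle.
   Context: $K_n^4$ denotes the complete $4$-uniform hypergraph on $n$ vertices. A Hamiltonian Berge-cycle in a hypergraph on $n$ vertices consists of an ordering $v_1,\dots,v_n$ of all vertices (the core sequence) together with distinct edges $e_1,\dots,e_n$ such that $e_j$ contains $v_j$ and $v_{j+1}$ (indices modulo $n$). It is monochromatic if all of $e_1,\dots,e_n$ have the same color. -}

module Defs where

open import Data.Nat using (ℕ; suc; _%_; NonZero)
open import Data.Nat.DivMod using (m%n<n)
open import Data.Fin using (Fin; toℕ; fromℕ<; _<_)
open import Data.Product using (Σ; _×_; _,_; proj₁)
open import Data.Sum using (_⊎_)
open import Relation.Binary.PropositionalEquality using (_≡_)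
open import Function.Definitions using (Injective; Bijective)

-- A hyperedge of the complete 4-uniform hypergraph K_n^4 on vertex set Fin n:
-- a 4-element subset {a,b,c,d}, represented canonically as a strictly
-- increasing quadruple a < b < c < d (so equal subsets = equal quadruples).
record Edge4 (n : ℕ) : Set where
  constructor edge
  field
    a b c d : Fin n
    a<b : a < b
    b<c : b < c
    c<d : c < d
open Edge4 public

_∈ₑ_ : {n : ℕ} → Fin n → Edge4 n → Set
v ∈ₑ e = (v ≡ a e) ⊎ ((v ≡ b e) ⊎ ((v ≡ c e) ⊎ (v ≡ d e)))

next : {n : ℕ} → .{{_ : NonZero n}} → Fin n → Fin n
next {n} j = fromℕ< (m%n<n (suc (toℕ j)) n)

MonoHamBergeCycle : (n : ℕ) → .{{_ : NonZero n}} → {k : ℕ} →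
                    (Edge4 n → Fin k) → Set
MonoHamBergeCycle n {k} χ =
  Σ (Fin n → Fin n) λ v →
  Σ (Fin n → Edge4 n) λ e →
  Σ (Fin k) λ col →
    Bijective _≡_ _≡_ v ×
    Injective _≡_ _≡_ e ×
    ((j : Fin n) → (v j ∈ₑ e j) × (v (next j) ∈ₑ e j) × (χ (e j) ≡ col))

{-# OPTIONS --safe #-}

-- Suppose there is no monochromatic Hamiltonian Berge-cycle.  For each colour κ
-- let Q be a maximal graph such that the hyperedges of colour κ, each usable once,
-- together with the freely usable edges of Q contain no Hamiltonian cycle.  Q is not
-- complete, and any missing pair u v is joined by a Hamiltonian path.  Crossing two
-- further edges over that path (Bondy–Chvátal) shows that the missing degrees of u
-- and v add up to at least n - 1, that all hyperedges of colour κ through u v lie on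
-- the path, and that u and v cannot both have many neighbours in colour κ.  As every
-- triple of vertices has n - 3 extensions, this excludes, for n ≥ 85, pairs missing
-- in two colours and stars, triangles or paths of three pairs missing in three
-- different colours.  Counting degrees, no vertex then lies on missing pairs of two
-- colours, whereas in each colour more than half of the vertices lie on missing pairs.
module Submission where

open import Defs
open import Algebra.Solver.CommutativeMonoid as CommutativeMonoidSolver using ()
open import Data.Bool using (if_then_else_)
open import Data.Empty using (⊥)
open import Data.Fin as Fin using (Fin; zero; suc; toℕ; fromℕ<)
open import Data.Fin.Properties as Fin using (_≟_; any?; all?; pigeonhole; toℕ<n; toℕ-fromℕ<; toℕ-injective)
open import Data.List using (List; []; _∷_; _++_; length; map; tabulate; allFin; cartesianProduct)
open import Data.List.Properties using (map-tabulate; length-tabulate; length-++; ++-assoc; ++-identityʳ)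
open import Data.List.Membership.DecPropositional as DecMembership using ()
open import Data.List.Membership.Propositional using (_∈_; _∉_)
open import Data.List.Membership.Propositional.Properties using (∈-allFin; ∈-cartesianProduct⁺; ∈-++⁺ʳ)
open import Data.List.Relation.Binary.Permutation.Propositional using (_↭_; ↭-refl; ↭-sym; ↭-trans; ↭-reflexive; ↭⇒↭ₛ; prep)
open import Data.List.Relation.Binary.Permutation.Propositional.Properties using (map⁺; ++⁺; ++⁺ˡ; ++⁺ʳ; ++-comm; ++-commutativeMonoid; ↭-length; ∈-resp-↭)
open import Data.List.Relation.Binary.Permutation.Setoid.Properties as SetoidPermutation using ()
open import Data.List.Relation.Unary.All as All using ([]; _∷_)
open import Data.List.Relation.Unary.All.Properties as All using (¬Any⇒All¬; All¬⇒¬Any)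
open import Data.List.Relation.Unary.AllPairs using ([]; _∷_)
open import Data.List.Relation.Unary.Any as Any using (Any; here; there)
open import Data.List.Relation.Unary.Unique.Propositional using (Unique)
open import Data.List.Relation.Unary.Unique.Propositional.Properties using (allFin⁺)
open import Data.Nat using (ℕ; zero; suc; _+_; _*_; _%_; _≤_; _<_; z≤n; s≤s; NonZero)
open import Data.Nat.DivMod using (m<n⇒m%n≡m; n%n≡0; m%n<n)
open import Data.Nat.ListAction using (sum)
open import Data.Nat.ListAction.Properties using (sum-↭)
open import Data.Nat.Properties using (≤-refl; ≤-reflexive; ≤-trans; ≤-total; <-irrelevant; 1+n≰n; m≤m+n; m≤n+m; m≤n⇒m<n∨m≡n; +-identityʳ; +-mono-≤; +-monoʳ-≤; +-cancelʳ-≤; *-identityʳ; *-zeroʳ; *-monoʳ-≤)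
open import Data.Nat.Tactic.RingSolver using (solve-∀)
open import Data.Product using (Σ; ∃; ∃₂; _×_; _,_; _,′_; proj₁; proj₂)
open import Data.Product.Properties using (≡-dec)
open import Data.Sum as Sum using (_⊎_; inj₁; inj₂; [_,_]′)
open import Data.Vec.Functional as Vector using ()
open import Function using (_∘_; id; case_of_)
open import Function.Definitions using (Injective; Surjective)
open import Relation.Binary.Definitions using (tri<; tri≈; tri>; DecidableEquality)
open import Relation.Binary.PropositionalEquality using (_≡_; _≢_; _≗_; refl; sym; trans; cong; cong₂; subst; ≢-sym; setoid)
open import Relation.Nullary using (¬_; Dec; yes; no; does; _×-dec_; _⊎-dec_; _→-dec_; ¬?; contradiction)
open import Relation.Nullary.Decidable using (map′; decidable-stable; ¬¬-excluded-middle)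
open import Relation.Unary using (Decidable)

-- Counting

bit : {A : Set} → Dec A → ℕ
bit d = if does d then 1 else 0

module _ {A : Set} where

  bit-yes : (d : Dec A) → A → bit d ≡ 1
  bit-yes (yes _) _ = refl
  bit-yes (no ¬a) a = contradiction a ¬a

  bit-no : (d : Dec A) → ¬ A → bit d ≡ 0
  bit-no (yes a) ¬a = contradiction a ¬a
  bit-no (no _)  _  = refl

  bit≤0 : (d : Dec A) → ¬ A → bit d ≤ 0
  bit≤0 d ¬a = ≤-reflexive (bit-no d ¬a)

  bit≤1 : (d : Dec A) → bit d ≤ 1
  bit≤1 (yes _) = ≤-refl
  bit≤1 (no _)  = z≤n

  bit-≤ : (d : Dec A) {k : ℕ} → (A → 1 ≤ k) → bit d ≤ k
  bit-≤ (yes a) f = f a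
  bit-≤ (no _)  _ = z≤n

  1≤bit : (d : Dec A) → A → 1 ≤ bit d
  1≤bit d a = ≤-reflexive (sym (bit-yes d a))

  -- Lets a sum of indicators be bounded one summand at a time: the remaining sum has to drop by one
  -- only where the first event holds.
  bit+-≤ : (d : Dec A) {k l : ℕ} → k ≤ suc l → (A → k ≤ l) → bit d + k ≤ suc l
  bit+-≤ (yes a) _    k≤l = s≤s (k≤l a)
  bit+-≤ (no _)  k≤1+l _  = k≤1+l

bit-⊎ : {A B : Set} (p : Dec A) (q : Dec B) → bit (p ⊎-dec q) ≤ bit p + bit q
bit-⊎ (yes _) q = s≤s z≤n
bit-⊎ (no _)  q = ≤-refl

1≤bit+bit : {A B : Set} (p : Dec A) (q : Dec B) → A ⊎ B → 1 ≤ bit p + bit q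
1≤bit+bit p q (inj₁ a) = ≤-trans (1≤bit p a) (m≤m+n (bit p) (bit q))
1≤bit+bit p q (inj₂ b) = ≤-trans (1≤bit q b) (m≤n+m (bit q) (bit p))

bit-cover : {A B C : Set} (p : Dec A) (q : Dec B) (r : Dec C) → (A → B ⊎ C) → bit p ≤ bit q + bit r
bit-cover p q r f = bit-≤ p (1≤bit+bit q r ∘ f)

bit-disjoint : {A B C : Set} (p : Dec A) (q : Dec B) (r : Dec C) →
               (A → ¬ B) → (A ⊎ B → C) → bit p + bit q ≤ bit r
bit-disjoint (yes a) q r disjoint f rewrite bit-no q (disjoint a) = 1≤bit r (f (inj₁ a))
bit-disjoint (no _)  q r _        f = bit-≤ q (1≤bit r ∘ f ∘ inj₂)

total : {n : ℕ} → (Fin n → ℕ) → ℕ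
total f = sum (tabulate f)

total-mono : ∀ {n} {f g : Fin n → ℕ} → (∀ x → f x ≤ g x) → total f ≤ total g
total-mono {zero}  f≤g = z≤n
total-mono {suc n} f≤g = +-mono-≤ (f≤g zero) (total-mono (f≤g ∘ suc))

total-+ : ∀ {n} (f g : Fin n → ℕ) → total (λ x → f x + g x) ≡ total f + total g
total-+ {zero}  f g = refl
total-+ {suc n} f g = trans (cong (f zero + g zero +_) (total-+ (f ∘ suc) (g ∘ suc)))
                            (interchange (f zero) (g zero) _ _)
  where
  interchange : ∀ a b c d → (a + b) + (c + d) ≡ (a + c) + (b + d)
  interchange = solve-∀

total-const : ∀ n k → total {n} (λ _ → k) ≡ n * k
total-const zero    k = refl
total-const (suc n) k = cong (k +_) (total-const n k)

total-single : ∀ {n} (x : Fin n) → total (λ y → bit (y ≟ x)) ≡ 1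
total-single {suc n} zero    = cong suc (trans (total-const n 0) (*-zeroʳ n))
total-single {suc n} (suc x) = total-single x

total-≤0 : ∀ {n} {P : Fin n → Set} (P? : Decidable P) → (∀ x → ¬ P x) → total (bit ∘ P?) ≤ 0
total-≤0 {zero}  P? ¬P = z≤n
total-≤0 {suc n} P? ¬P rewrite bit-no (P? zero) (¬P zero) = total-≤0 (P? ∘ suc) (¬P ∘ suc)

total-unique : ∀ {n} {P : Fin n → Set} (P? : Decidable P) → (∀ {x y} → P x → P y → x ≡ y) →
               total (bit ∘ P?) ≤ bit (any? P?)
total-unique P? unique with any? P?
... | no ¬∃       = total-≤0 P? λ x Px → ¬∃ (x , Px)
... | yes (x , Px) = ≤-trans (total-mono λ y → bit-≤ (P? y) λ Py → 1≤bit (y ≟ x) (unique Py Px))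
                             (≤-reflexive (total-single x))

sumOver : {A : Set} → (A → ℕ) → List A → ℕ
sumOver f xs = sum (map f xs)

sumOver-cover : ∀ {n} (f : Fin n → ℕ) {vs} → vs ↭ allFin n → sumOver f vs ≡ total f
sumOver-cover f vs↭ = trans (sum-↭ (map⁺ f vs↭)) (cong sum (map-tabulate id f))

-- A contradiction between linear inequalities is obtained by adding them up.
too-big : ∀ {a b} d → a ≤ b → a ≡ suc (b + d) → ⊥
too-big {a} {b} d a≤b refl = 1+n≰n (≤-trans (s≤s (m≤m+n b d)) a≤b)

-- Edges and triples

edge-≡ : ∀ {n} {e f : Edge4 n} → a e ≡ a f → b e ≡ b f → c e ≡ c f → d e ≡ d f → e ≡ f
edge-≡ {e = edge p q r s l₁ l₂ l₃} {edge _ _ _ _ m₁ m₂ m₃} refl refl refl refl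
  with refl ← <-irrelevant l₁ m₁ | refl ← <-irrelevant l₂ m₂ | refl ← <-irrelevant l₃ m₃ = refl

_≟ₑ_ : ∀ {n} → DecidableEquality (Edge4 n)
e ≟ₑ f = map′ (λ (p , q , r , s) → edge-≡ p q r s) (λ { refl → refl , refl , refl , refl })
  ((a e ≟ a f) ×-dec (b e ≟ b f) ×-dec (c e ≟ c f) ×-dec (d e ≟ d f))

_∈ₑ?_ : ∀ {n} (v : Fin n) (e : Edge4 n) → Dec (v ∈ₑ e)
v ∈ₑ? e = (v ≟ a e) ⊎-dec (v ≟ b e) ⊎-dec (v ≟ c e) ⊎-dec (v ≟ d e)

-- An edge is determined by its four vertices, since proofs of `<` are irrelevant; so it suffices to
-- search all quadruples.
anyEdge? : ∀ {n} {P : Edge4 n → Set} → Decidable P → Dec (∃ P)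
anyEdge? {n} {P} P? = map′
  (λ (a , b , c , d , (a<b , b<c , c<d) , p) → edge a b c d a<b b<c c<d , p)
  (λ (edge a b c d a<b b<c c<d , p) → a , b , c , d , (a<b , b<c , c<d) , p)
  (any? λ a → any? λ b → any? λ c → any? λ d → at a b c d)
  where
  at : ∀ a b c d → Dec (Σ (a Fin.< b × b Fin.< c × c Fin.< d) λ (p , q , r) → P (edge a b c d p q r))
  at a b c d with a Fin.<? b | b Fin.<? c | c Fin.<? d
  ... | no ¬p | _ | _ = no λ ((p , _) , _) → ¬p p
  ... | yes _ | no ¬q | _ = no λ ((_ , q , _) , _) → ¬q q
  ... | yes _ | yes _ | no ¬r = no λ ((_ , _ , r) , _) → ¬r r
  ... | yes p | yes q | yes r = map′ (λ x → (p , q , r) , x)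
    (λ (_ , x) → subst P (edge-≡ refl refl refl refl) x) (P? (edge a b c d p q r))

-- Unlike `Edge4`, a triple is not sorted: only membership in it matters, and later arguments list
-- its vertices in whatever order is convenient.
record Triple (n : ℕ) : Set where
  constructor triple
  field
    {x y z} : Fin n
    x≢y : x ≢ y
    x≢z : x ≢ z
    y≢z : y ≢ z

module _ {n : ℕ} where

  infix 4 _∈₃_ _∈₃?_ _⊆ₑ_ _⊆ₑ?_

  _∈₃_ : Fin n → Triple n → Set
  v ∈₃ T = v ≡ x ⊎ v ≡ y ⊎ v ≡ z
    where open Triple T

  _∈₃?_ : (v : Fin n) (T : Triple n) → Dec (v ∈₃ T)
  v ∈₃? T = (v ≟ x) ⊎-dec (v ≟ y) ⊎-dec (v ≟ z)
    where open Triple T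

  _⊆ₑ_ : Triple n → Edge4 n → Set
  T ⊆ₑ e = x ∈ₑ e × y ∈ₑ e × z ∈ₑ e
    where open Triple T

  _⊆ₑ?_ : (T : Triple n) (e : Edge4 n) → Dec (T ⊆ₑ e)
  T ⊆ₑ? e = (x ∈ₑ? e) ×-dec (y ∈ₑ? e) ×-dec (z ∈ₑ? e)
    where open Triple T

  ⊆ₑ-∈ : ∀ {T e v} → T ⊆ₑ e → v ∈₃ T → v ∈ₑ e
  ⊆ₑ-∈ (p , _ , _) (inj₁ refl)        = p
  ⊆ₑ-∈ (_ , q , _) (inj₂ (inj₁ refl)) = q
  ⊆ₑ-∈ (_ , _ , r) (inj₂ (inj₂ refl)) = r

  total-triple : ∀ T → total (λ v → bit (v ∈₃? T)) ≤ 3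
  total-triple T = ≤-trans (total-mono pointwise) (≤-reflexive sum≡3)
    where
    open Triple T
    pointwise : ∀ v → bit (v ∈₃? T) ≤ bit (v ≟ x) + (bit (v ≟ y) + bit (v ≟ z))
    pointwise v = ≤-trans (bit-⊎ (v ≟ x) ((v ≟ y) ⊎-dec (v ≟ z)))
      (+-monoʳ-≤ (bit (v ≟ x)) (bit-⊎ (v ≟ y) (v ≟ z)))
    sum≡3 : total (λ v → bit (v ≟ x) + (bit (v ≟ y) + bit (v ≟ z))) ≡ 3
    sum≡3 = trans (total-+ _ (λ v → bit (v ≟ y) + bit (v ≟ z)))
      (cong₂ _+_ (total-single x) (trans (total-+ _ (λ v → bit (v ≟ z))) (cong₂ _+_ (total-single y) (total-single z))))

  position : ∀ {v} {e : Edge4 n} → v ∈ₑ e → Fin 4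
  position (inj₁ _)               = zero
  position (inj₂ (inj₁ _))        = suc zero
  position (inj₂ (inj₂ (inj₁ _))) = suc (suc zero)
  position (inj₂ (inj₂ (inj₂ _))) = suc (suc (suc zero))

  member : Edge4 n → Fin 4 → Fin n
  member e zero                   = a e
  member e (suc zero)             = b e
  member e (suc (suc zero))       = c e
  member e (suc (suc (suc zero))) = d e

  member-position : ∀ {v e} (p : v ∈ₑ e) → member e (position {e = e} p) ≡ v
  member-position (inj₁ p)               = sym p
  member-position (inj₂ (inj₁ p))        = sym p
  member-position (inj₂ (inj₂ (inj₁ p))) = sym p
  member-position (inj₂ (inj₂ (inj₂ p))) = sym p

  -- Pigeonhole: the three vertices of `T` together with `v` and `w` occupy only four positions of
  -- `e`, and `v ≡ w` is the only coincidence possible.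
  fourth-unique : ∀ {T e v w} → T ⊆ₑ e → v ∈ₑ e → w ∈ₑ e → ¬ v ∈₃ T → ¬ w ∈₃ T → v ≡ w
  fourth-unique {T} {e} {v} {w} (x∈e , y∈e , z∈e) v∈e w∈e v∉T w∉T =
    let i , j , i<j , eq = pigeonhole ≤-refl (λ i → position {e = e} (proj₂ (members i)))
    in decide i j i<j (trans (sym (member-position (proj₂ (members i))))
         (trans (cong (member e) eq) (member-position (proj₂ (members j)))))
    where
    open Triple T
    members : Fin 5 → ∃ (_∈ₑ e)
    members zero                         = x , x∈e
    members (suc zero)                   = y , y∈e
    members (suc (suc zero))             = z , z∈e
    members (suc (suc (suc zero)))       = v , v∈e
    members (suc (suc (suc (suc zero)))) = w , w∈e

    decide : ∀ i j → i Fin.< j → proj₁ (members i) ≡ proj₁ (members j) → v ≡ w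
    decide zero (suc zero) _ eq = contradiction eq x≢y
    decide zero (suc (suc zero)) _ eq = contradiction eq x≢z
    decide zero (suc (suc (suc zero))) _ eq = contradiction (inj₁ (sym eq)) v∉T
    decide zero (suc (suc (suc (suc zero)))) _ eq = contradiction (inj₁ (sym eq)) w∉T
    decide (suc zero) (suc (suc zero)) _ eq = contradiction eq y≢z
    decide (suc zero) (suc (suc (suc zero))) _ eq = contradiction (inj₂ (inj₁ (sym eq))) v∉T
    decide (suc zero) (suc (suc (suc (suc zero)))) _ eq = contradiction (inj₂ (inj₁ (sym eq))) w∉T
    decide (suc (suc zero)) (suc (suc (suc zero))) _ eq = contradiction (inj₂ (inj₂ (sym eq))) v∉T
    decide (suc (suc zero)) (suc (suc (suc (suc zero)))) _ eq = contradiction (inj₂ (inj₂ (sym eq))) w∉T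
    decide (suc (suc (suc zero))) (suc (suc (suc (suc zero)))) _ eq = eq
    decide (suc zero) (suc zero) (s≤s ()) _
    decide (suc (suc zero)) (suc zero) (s≤s ()) _
    decide (suc (suc zero)) (suc (suc zero)) (s≤s (s≤s ())) _
    decide (suc (suc (suc i))) (suc zero) (s≤s ()) _
    decide (suc (suc (suc i))) (suc (suc zero)) (s≤s (s≤s ())) _
    decide (suc (suc (suc zero))) (suc (suc (suc zero))) (s≤s (s≤s (s≤s ()))) _
    decide (suc (suc (suc (suc zero)))) (suc (suc (suc zero))) (s≤s (s≤s (s≤s ()))) _
    decide (suc (suc (suc (suc zero)))) (suc (suc (suc (suc zero)))) (s≤s (s≤s (s≤s (s≤s ())))) _

  private
    In₂ : (p q v : Fin n) → Set
    In₂ p q v = v ≡ p ⊎ v ≡ q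

    In₃ : (p q r v : Fin n) → Set
    In₃ p q r v = v ≡ p ⊎ v ≡ q ⊎ v ≡ r

    -- First stage of an insertion sort that turns four distinct vertices into an increasing
    -- quadruple. Membership is tracked in both directions, because the next stage must know that
    -- its vertex is new.
    insert₂ : ∀ {x y} → x ≢ y →
      ∃₂ λ p q → p Fin.< q × (∀ {v} → v ≡ x ⊎ v ≡ y → In₂ p q v) × (∀ {v} → In₂ p q v → v ≡ x ⊎ v ≡ y)
    insert₂ {x} {y} x≢y with Fin.<-cmp x y
    ... | tri< x<y _ _ = x , y , x<y , id , id
    ... | tri≈ _ eq _  = contradiction eq x≢y
    ... | tri> _ _ y<x = y , x , y<x , Sum.swap , Sum.swap

    insert₃ : ∀ {p q z} → p Fin.< q → ¬ In₂ p q z →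
      ∃₂ λ p′ q′ → ∃ λ r′ → p′ Fin.< q′ × q′ Fin.< r′ ×
        (∀ {v} → In₂ p q v ⊎ v ≡ z → In₃ p′ q′ r′ v) × (∀ {v} → In₃ p′ q′ r′ v → In₂ p q v ⊎ v ≡ z)
    insert₃ {p} {q} {z} p<q z∉ with Fin.<-cmp z p | Fin.<-cmp z q
    ... | tri≈ _ eq _  | _ = contradiction (inj₁ eq) z∉
    ... | tri< z<p _ _ | _ = z , p , q , z<p , p<q , Sum.swap , Sum.swap
    ... | tri> _ _ _   | tri≈ _ eq _  = contradiction (inj₂ eq) z∉
    ... | tri> _ _ p<z | tri< z<q _ _ = p , z , q , p<z , z<q ,
      (λ { (inj₁ (inj₁ e)) → inj₁ e ; (inj₁ (inj₂ e)) → inj₂ (inj₂ e) ; (inj₂ e) → inj₂ (inj₁ e) }) ,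
      (λ { (inj₁ e) → inj₁ (inj₁ e) ; (inj₂ (inj₁ e)) → inj₂ e ; (inj₂ (inj₂ e)) → inj₁ (inj₂ e) })
    ... | tri> _ _ _   | tri> _ _ q<z = p , q , z , p<q , q<z , Sum.assocʳ , Sum.assocˡ

    insert₄ : ∀ {p q r w} → p Fin.< q → q Fin.< r → ¬ In₃ p q r w →
      ∃ λ (e : Edge4 n) → ∀ {v} → In₃ p q r v ⊎ v ≡ w → v ∈ₑ e
    insert₄ {p} {q} {r} {w} p<q q<r w∉ with Fin.<-cmp w p | Fin.<-cmp w q | Fin.<-cmp w r
    ... | tri≈ _ eq _  | _ | _ = contradiction (inj₁ eq) w∉
    ... | tri< w<p _ _ | _ | _ = edge w p q r w<p p<q q<r , Sum.swap
    ... | tri> _ _ _   | tri≈ _ eq _  | _ = contradiction (inj₂ (inj₁ eq)) w∉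
    ... | tri> _ _ p<w | tri< w<q _ _ | _ = edge p w q r p<w w<q q<r ,
      λ { (inj₁ (inj₁ e)) → inj₁ e ; (inj₁ (inj₂ e)) → inj₂ (inj₂ e) ; (inj₂ e) → inj₂ (inj₁ e) }
    ... | tri> _ _ _   | tri> _ _ _   | tri≈ _ eq _  = contradiction (inj₂ (inj₂ eq)) w∉
    ... | tri> _ _ _   | tri> _ _ q<w | tri< w<r _ _ = edge p q w r p<q q<w w<r ,
      λ { (inj₁ (inj₁ e)) → inj₁ e ; (inj₁ (inj₂ (inj₁ e))) → inj₂ (inj₁ e)
        ; (inj₁ (inj₂ (inj₂ e))) → inj₂ (inj₂ (inj₂ e)) ; (inj₂ e) → inj₂ (inj₂ (inj₁ e)) }
    ... | tri> _ _ _   | tri> _ _ _   | tri> _ _ r<w = edge p q r w p<q q<r r<w ,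
      λ { (inj₁ (inj₁ e)) → inj₁ e ; (inj₁ (inj₂ (inj₁ e))) → inj₂ (inj₁ e)
        ; (inj₁ (inj₂ (inj₂ e))) → inj₂ (inj₂ (inj₁ e)) ; (inj₂ e) → inj₂ (inj₂ (inj₂ e)) }

  edge-through : ∀ T {w} → ¬ w ∈₃ T → ∃ λ e → T ⊆ₑ e × w ∈ₑ e
  edge-through (triple x≢y x≢z y≢z) w∉T
    with p , q , p<q , to₂ , from₂ ← insert₂ x≢y
    with _ , _ , _ , p<q , q<r , to₃ , from₃ ← insert₃ p<q ([ x≢z ∘ sym , y≢z ∘ sym ]′ ∘ from₂)
    with e , to₄ ← insert₄ p<q q<r (λ w∈ → w∉T (Sum.assocʳ (Sum.map₁ from₂ (from₃ w∈))))
    = e , (to₄ (inj₁ (to₃ (inj₁ (to₂ (inj₁ refl))))) , to₄ (inj₁ (to₃ (inj₁ (to₂ (inj₂ refl))))) ,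
           to₄ (inj₁ (to₃ (inj₂ refl)))) , to₄ (inj₂ refl)

-- Hamiltonian Berge-paths

Unique-resp-↭ : {A : Set} {xs ys : List A} → xs ↭ ys → Unique xs → Unique ys
Unique-resp-↭ xs↭ys = SetoidPermutation.Unique-resp-↭ (setoid _) (↭⇒↭ₛ xs↭ys)

Unique-++⁻ʳ : {A : Set} (xs : List A) {ys : List A} → Unique (xs ++ ys) → Unique ys
Unique-++⁻ʳ []       ys!       = ys!
Unique-++⁻ʳ (x ∷ xs) (_ ∷ ys!) = Unique-++⁻ʳ xs ys!

Unique-++⁻ˡ : {A : Set} (xs : List A) {ys : List A} → Unique (xs ++ ys) → Unique xs
Unique-++⁻ˡ []       _          = []
Unique-++⁻ˡ (x ∷ xs) (x∉ ∷ xs!) = All.++⁻ˡ xs x∉ ∷ Unique-++⁻ˡ xs xs!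

Unique-++⇒disjoint : {A : Set} (xs : List A) {ys : List A} {v : A} → Unique (xs ++ ys) → v ∈ xs → v ∉ ys
Unique-++⇒disjoint (x ∷ xs) (x∉ ∷ _)  (here refl)  v∈ys = All¬⇒¬Any x∉ (∈-++⁺ʳ xs v∈ys)
Unique-++⇒disjoint (x ∷ xs) (_ ∷ xs!) (there v∈xs) v∈ys = Unique-++⇒disjoint xs xs! v∈xs v∈ys

-- The edges of the graph Q may be traversed freely; a hyperedge of colour κ may
-- be used once, so the last index of a step or a path lists the hyperedges it uses.
module Berge {n k : ℕ} (χ : Edge4 n → Fin k) (κ : Fin k) where

  Graph : Set
  Graph = List (Fin n × Fin n)

  open DecMembership (≡-dec (_≟_ {n}) (_≟_ {n})) using () renaming (_∈?_ to _∈Q?_)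

  Adj : Graph → Fin n → Fin n → Set
  Adj Q u v = u ≢ v × ((u , v) ∈ Q ⊎ (v , u) ∈ Q)

  Adj? : ∀ Q u v → Dec (Adj Q u v)
  Adj? Q u v = ¬? (u ≟ v) ×-dec (((u , v) ∈Q? Q) ⊎-dec ((v , u) ∈Q? Q))

  Adj-sym : ∀ {Q u v} → Adj Q u v → Adj Q v u
  Adj-sym (u≢v , uv) = ≢-sym u≢v , Sum.swap uv

  data Step (Q : Graph) (u v : Fin n) : List (Edge4 n) → Set where
    hyper : ∀ e → u ≢ v → u ∈ₑ e → v ∈ₑ e → χ e ≡ κ → Step Q u v (e ∷ [])
    free  : Adj Q u v → Step Q u v []

  infixr 5 _∷_

  data Path (Q : Graph) : Fin n → Fin n → List (Fin n) → List (Edge4 n) → Set where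
    [_] : ∀ v → Path Q v v (v ∷ []) []
    _∷_ : ∀ {u v w vs es fs} → Step Q u v fs → Path Q v w vs es → Path Q u w (u ∷ vs) (fs ++ es)

  record HamPath (Q : Graph) (u v : Fin n) : Set where
    field
      {vertices} : List (Fin n)
      {edges}    : List (Edge4 n)
      path       : Path Q u v vertices edges
      cover      : vertices ↭ allFin n
      distinct   : Unique edges

  record HamCycle (Q : Graph) : Set where
    field
      {start end}     : Fin n
      {vertices}      : List (Fin n)
      {edges closing} : List (Edge4 n)
      path            : Path Q start end vertices edges
      close           : Step Q end start closing
      cover           : vertices ↭ allFin n
      distinct        : Unique (closing ++ edges)

  module _ {Q : Graph} where

    step-sym : ∀ {u v fs} → Step Q u v fs → Step Q v u fs
    step-sym (hyper e u≢v u∈e v∈e eq) = hyper e (≢-sym u≢v) v∈e u∈e eq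
    step-sym (free uv)                = free (Adj-sym uv)

    join : ∀ {u v w x vs vs′ es fs es′} → Path Q u v vs es → Step Q v w fs → Path Q w x vs′ es′ →
           Path Q u x (vs ++ vs′) (es ++ fs ++ es′)
    join [ _ ] s q = s ∷ q
    join {vs′ = vs′} {fs = fs} {es′ = es′} (_∷_ {es = es} {fs = gs} t p) s q =
      subst (Path Q _ _ _) (sym (++-assoc gs es (fs ++ es′))) (t ∷ join p s q)

    reversePath : ∀ {u v vs es} → Path Q u v vs es →
                  ∃₂ λ vs′ es′ → Path Q v u vs′ es′ × vs′ ↭ vs × es′ ↭ es
    reversePath [ v ] = _ , _ , [ v ] , ↭-refl , ↭-refl
    reversePath (_∷_ {u} {vs = vs} {es = es} {fs = fs} s p)
      with vs′ , es′ , p′ , vs′↭ , es′↭ ← reversePath p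
      = vs′ ++ u ∷ [] , es′ ++ fs ++ [] , join p′ (step-sym s) [ u ]
      , ↭-trans (++-comm vs′ (u ∷ [])) (prep u vs′↭)
      , ↭-trans (++-comm es′ (fs ++ [])) (++⁺ (↭-reflexive (++-identityʳ fs)) es′↭)

    reverseHam : ∀ {u v} → HamPath Q u v → HamPath Q v u
    reverseHam P with vs′ , es′ , p′ , vs′↭ , es′↭ ← reversePath (HamPath.path P) = record
      { path     = p′
      ; cover    = ↭-trans vs′↭ (HamPath.cover P)
      ; distinct = Unique-resp-↭ (↭-sym es′↭) (HamPath.distinct P)
      }

    start∈ : ∀ {u v vs es} → Path Q u v vs es → u ∈ vs
    start∈ [ _ ]   = here refl
    start∈ (_ ∷ _) = here refl

    end∈ : ∀ {u v vs es} → Path Q u v vs es → v ∈ vs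
    end∈ [ _ ]   = here refl
    end∈ (_ ∷ p) = there (end∈ p)

    closeHam : ∀ {u v fs} (P : HamPath Q u v) → Step Q v u fs → Unique (fs ++ HamPath.edges P) → HamCycle Q
    closeHam P s fs! = record
      { path = HamPath.path P ; close = s ; cover = HamPath.cover P ; distinct = fs! }

    -- A place to cut the path for the Bondy-Chvátal exchange: a step from `x` to its successor `y`
    -- with `R x` and `P y`.
    Split : ∀ {u v vs es} → (P R : Fin n → Set) → Path Q u v vs es → Set
    Split {u} {v} {vs} {es} P R _ =
      ∃₂ λ x y → P y × R x ×
      ∃₂ λ vs₁ vs₂ → ∃₂ λ es₁ es₂ → ∃ λ fs →
      Path Q u x vs₁ es₁ × Step Q x y fs × Path Q y v vs₂ es₂ ×
      vs ≡ vs₁ ++ vs₂ × es ≡ es₁ ++ fs ++ es₂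

    -- Without such a cut, shifting the positions in `R` by one along the path gives positions
    -- outside `P`. No shifted position is the first one, and none falls off the end because `v` is
    -- not in `R`. The term `bit (P? u)` allows for the first position.
    split-or-sparse : ∀ {P R : Fin n → Set} (P? : Decidable P) (R? : Decidable R) →
      ∀ {u v vs es} (p : Path Q u v vs es) → ¬ R v →
      Split P R p ⊎
      suc (sumOver (bit ∘ P?) vs + sumOver (bit ∘ R?) vs) ≤ length vs + bit (P? u)
    split-or-sparse P? R? [ v ] ¬Rv rewrite bit-no (R? v) ¬Rv = inj₂ (≤-reflexive (lemma (bit (P? v))))
      where
      lemma : ∀ p → suc (p + 0 + 0) ≡ 1 + p
      lemma = solve-∀
    split-or-sparse P? R? (_∷_ {u} {v} {vs = vs} {es = es} {fs = fs} s p) ¬Rw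
      with split-or-sparse P? R? p ¬Rw
    ... | inj₁ (x , y , Py , Rx , vs₁ , vs₂ , es₁ , es₂ , gs , p₁ , t , p₂ , refl , refl) =
      inj₁ (x , y , Py , Rx , u ∷ vs₁ , vs₂ , fs ++ es₁ , es₂ , gs , s ∷ p₁ , t , p₂ , refl
           , sym (++-assoc fs es₁ (gs ++ es₂)))
    ... | inj₂ bound with P? v | R? u
    ... | yes Pv | yes Ru = inj₁ (u , v , Pv , Ru , _ , _ , _ , _ , fs , [ u ] , s , p , refl , refl)
    ... | yes _  | no _ = inj₂ (≤-trans (≤-reflexive (lhs (bit (P? u)) _ _))
      (≤-trans (+-monoʳ-≤ (bit (P? u)) bound) (≤-reflexive (rhs (bit (P? u)) _))))
      where
      lhs : ∀ p a b → suc (p + a + b) ≡ p + suc (a + b)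
      lhs = solve-∀
      rhs : ∀ p l → p + (l + 1) ≡ suc l + p
      rhs = solve-∀
    ... | no _ | r? = inj₂ (≤-trans (≤-reflexive (lhs (bit (P? u)) _ (bit r?) _))
      (≤-trans (+-mono-≤ (+-mono-≤ (≤-refl {bit (P? u)}) (bit≤1 r?)) bound) (≤-reflexive (rhs (bit (P? u)) _))))
      where
      lhs : ∀ p a r b → suc (p + a + (r + b)) ≡ p + r + suc (a + b)
      lhs = solve-∀
      rhs : ∀ p l → p + 1 + (l + 0) ≡ suc l + p
      rhs = solve-∀

    -- If v is joined to the vertex x of the path and u to the successor y of x,
    -- then u … x y … v closes up to the cycle x … u y … v x.
    crossing : ∀ {u v} (H : HamPath Q u v) {P R : Fin n → Set} (P? : Decidable P) (R? : Decidable R) →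
      ¬ P u → ¬ R v →
      (∀ {x y} → P y → R x → ∃₂ λ fs gs → Step Q u y fs × Step Q v x gs × Unique (fs ++ gs ++ HamPath.edges H)) →
      HamCycle Q ⊎ suc (total (bit ∘ P?) + total (bit ∘ R?)) ≤ n
    crossing H {P} {R} P? R? ¬Pu ¬Rv steps with split-or-sparse P? R? (HamPath.path H) ¬Rv
    ... | inj₂ bound rewrite bit-no (P? _) ¬Pu
        | sumOver-cover (bit ∘ P?) (HamPath.cover H) | sumOver-cover (bit ∘ R?) (HamPath.cover H)
        | ↭-length (HamPath.cover H) | length-tabulate {n = n} id | +-identityʳ n = inj₂ bound
    ... | inj₁ (x , y , Py , Rx , vs₁ , vs₂ , es₁ , es₂ , hs , p₁ , _ , p₂ , refl , refl)
      with fs , gs , u→y , v→x , unique ← steps Py Rx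
         | vs₁′ , es₁′ , p₁′ , vs₁′↭ , es₁′↭ ← reversePath p₁ = inj₁ record
      { path     = join p₁′ u→y p₂
      ; close    = v→x
      ; cover    = ↭-trans (++⁺ʳ vs₂ vs₁′↭) (HamPath.cover H)
      -- The new cycle omits the step from `x` to `y`, so its hyperedges `hs` are moved to the front
      -- and dropped.
      ; distinct = Unique-++⁻ʳ hs (Unique-resp-↭ rearrange unique)
      }
      where
      open CommutativeMonoidSolver (++-commutativeMonoid {A = Edge4 n}) using (solve; _⊜_; _⊕_)
      rearrange : fs ++ gs ++ es₁ ++ hs ++ es₂ ↭ hs ++ gs ++ es₁′ ++ fs ++ es₂
      rearrange = ↭-trans
        (solve 5 (λ f g e h e′ → (f ⊕ (g ⊕ (e ⊕ (h ⊕ e′)))) ⊜ (h ⊕ (g ⊕ (e ⊕ (f ⊕ e′))))) ↭-refl fs gs es₁ hs es₂)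
        (++⁺ˡ hs (++⁺ˡ gs (++⁺ʳ (fs ++ es₂) (↭-sym es₁′↭))))

  -- Hyperedges through a triple

  Used : Triple n → List (Edge4 n) → Fin n → Set
  Used T es w = ¬ w ∈₃ T × Any (λ e → T ⊆ₑ e × w ∈ₑ e) es

  Used? : ∀ T es → Decidable (Used T es)
  Used? T es w = ¬? (w ∈₃? T) ×-dec Any.any? (λ e → (T ⊆ₑ? e) ×-dec (w ∈ₑ? e)) es

  -- A hyperedge containing `T` has only one vertex outside `T`, so at least one of the two distinct
  -- ends of its step lies in `T`, and a vertex of the path is an end of at most two steps. The
  -- first vertex has only one step so far; the summand `bit (u ∈₃? T)` keeps its second place free
  -- for the step prepended in the induction.
  used-≤ : ∀ T {Q u v vs es} → Path Q u v vs es →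
    total (bit ∘ Used? T es) + bit (u ∈₃? T) ≤ 2 * sumOver (λ w → bit (w ∈₃? T)) vs
  used-≤ T [ v ] = ≤-trans (+-mono-≤ none (≤-refl {bit (v ∈₃? T)}))
    (≤-trans (m≤m+n _ _) (≤-reflexive (lemma (bit (v ∈₃? T)))))
    where
    none : total (bit ∘ Used? T []) ≤ 0
    none = total-≤0 (Used? T []) λ { w (_ , ()) }
    lemma : ∀ t → 0 + t + t ≡ 2 * (t + 0)
    lemma = solve-∀
  used-≤ T (_∷_ {u} {v} {vs = vs} (free _) p) = ≤-trans
    (+-mono-≤ (≤-trans (m≤m+n _ (bit (v ∈₃? T))) (used-≤ T p)) (m≤m+n (bit (u ∈₃? T)) (bit (u ∈₃? T))))
    (≤-reflexive (lemma (bit (u ∈₃? T)) _))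
    where
    lemma : ∀ t s → 2 * s + (t + t) ≡ 2 * (t + s)
    lemma = solve-∀
  used-≤ T (_∷_ {u} {v} {vs = vs} {es = es} (hyper e u≢v u∈e v∈e _) p) = ≤-trans
    (+-mono-≤ (≤-trans (total-mono pointwise) (≤-reflexive (total-+ (bit ∘ Here?) (bit ∘ Used? T es))))
      (≤-refl {bit (u ∈₃? T)}))
    (≤-trans (≤-reflexive (lhs (total (bit ∘ Here?)) _ _))
    (≤-trans (+-mono-≤ here-≤ (≤-refl {total (bit ∘ Used? T es) + bit (u ∈₃? T)}))
    (≤-trans (≤-reflexive (mid (bit (u ∈₃? T)) _ _))
    (≤-trans (+-mono-≤ (used-≤ T p) (≤-refl {bit (u ∈₃? T) + bit (u ∈₃? T)})) (≤-reflexive (rhs (bit (u ∈₃? T)) _))))))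
    where
    Here? : Decidable λ w → ¬ w ∈₃ T × T ⊆ₑ e × w ∈ₑ e
    Here? w = ¬? (w ∈₃? T) ×-dec (T ⊆ₑ? e) ×-dec (w ∈ₑ? e)
    pointwise : ∀ w → bit (Used? T (e ∷ es) w) ≤ bit (Here? w) + bit (Used? T es w)
    pointwise w = bit-cover (Used? T (e ∷ es) w) (Here? w) (Used? T es w) λ where
      (w∉T , here w∈e)   → inj₁ (w∉T , w∈e)
      (w∉T , there used) → inj₂ (w∉T , used)
    here-≤ : total (bit ∘ Here?) ≤ bit (u ∈₃? T) + bit (v ∈₃? T)
    here-≤ = ≤-trans
      (total-unique Here? λ (v∉T , T⊆e , v∈e) (w∉T , _ , w∈e) → fourth-unique {T = T} {e} T⊆e v∈e w∈e v∉T w∉T)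
      (bit-≤ (any? Here?) λ (_ , _ , T⊆e , _) → 1≤bit+bit (u ∈₃? T) (v ∈₃? T) (touch T⊆e))
      where
      touch : T ⊆ₑ e → u ∈₃ T ⊎ v ∈₃ T
      touch T⊆e with u ∈₃? T | v ∈₃? T
      ... | yes u∈T | _       = inj₁ u∈T
      ... | no _    | yes v∈T = inj₂ v∈T
      ... | no u∉T  | no v∉T  = contradiction (fourth-unique {T = T} {e} T⊆e u∈e v∈e u∉T v∉T) u≢v
    lhs : ∀ h s t → h + s + t ≡ h + (s + t)
    lhs = solve-∀
    mid : ∀ t t′ s → t + t′ + (s + t) ≡ s + t′ + (t + t)
    mid = solve-∀
    rhs : ∀ t s → 2 * s + (t + t) ≡ 2 * (t + s)
    rhs = solve-∀

  -- Each of the three vertices of `T` occurs once on the path and is charged at most twice.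
  used-≤6 : ∀ T {Q u v} (P : HamPath Q u v) → total (bit ∘ Used? T (HamPath.edges P)) ≤ 6
  used-≤6 T {u = u} P = ≤-trans (m≤m+n _ (bit (u ∈₃? T))) (≤-trans (used-≤ T (HamPath.path P))
    (*-monoʳ-≤ 2 (≤-trans (≤-reflexive (sumOver-cover _ (HamPath.cover P))) (total-triple T))))

  Completes : Triple n → Fin n → Set
  Completes T w = ¬ w ∈₃ T × ∃ λ e → (T ⊆ₑ e × w ∈ₑ e) × χ e ≡ κ

  Completes? : ∀ T → Decidable (Completes T)
  Completes? T w = ¬? (w ∈₃? T) ×-dec anyEdge? λ e → ((T ⊆ₑ? e) ×-dec (w ∈ₑ? e)) ×-dec (χ e ≟ κ)

  -- The number of hyperedges of colour `κ` containing `T`, counted by their fourth vertices.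
  codegree : Triple n → ℕ
  codegree T = total (bit ∘ Completes? T)

  degree : Graph → Fin n → ℕ
  degree Q u = total (bit ∘ Adj? Q u)

  module _ {Q : Graph} (no-cycle : ¬ HamCycle Q) where

    open DecMembership (_≟ₑ_ {n}) using () renaming (_∈?_ to _∈E?_)

    -- The classical exchange with both new steps taken from `Q`: free steps use no hyperedge, so
    -- distinctness is kept and a crossing would give a cycle.
    degree-sum : ∀ {u v} → HamPath Q u v → suc (degree Q u + degree Q v) ≤ n
    degree-sum {u} {v} H = [ (λ cycle → contradiction cycle no-cycle) , id ]′
      (crossing H (Adj? Q u) (Adj? Q v) (λ (u≢u , _) → u≢u refl) (λ (v≢v , _) → v≢v refl)
        λ uy vx → [] , [] , free uy , free vx , HamPath.distinct H)

    codegree-inside : ∀ {u v T} → HamPath Q u v → u ≢ v → u ∈₃ T → v ∈₃ T → codegree T ≤ 6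
    codegree-inside {u} {v} {T} H u≢v u∈T v∈T = ≤-trans (total-mono λ w →
        bit-≤ (Completes? T w) λ compl → 1≤bit (Used? T (HamPath.edges H) w) (used compl)) (used-≤6 T H)
      where
      used : ∀ {w} → Completes T w → Used T (HamPath.edges H) w
      used (w∉T , e , (T⊆e , w∈e) , χe≡κ) with e ∈E? HamPath.edges H
      ... | yes e∈es = w∉T , Any.map (λ { refl → T⊆e , w∈e }) e∈es
      ... | no  e∉es = contradiction
        (closeHam H (hyper e (≢-sym u≢v) (⊆ₑ-∈ {T = T} {e} T⊆e v∈T) (⊆ₑ-∈ {T = T} {e} T⊆e u∈T) χe≡κ)
                         (¬Any⇒All¬ _ e∉es ∷ HamPath.distinct H)) no-cycle

    codegree-sum : ∀ {u v T T′} → HamPath Q u v → u ∈₃ T → ¬ v ∈₃ T → v ∈₃ T′ →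
                   suc (codegree T + codegree T′) ≤ n + 13
    codegree-sum {u} {v} {T} {T′} H u∈T v∉T v∈T′ =
      ≤-trans (s≤s (+-mono-≤ codegree-≤P codegree-≤R)) (≤-trans (≤-reflexive (lemma (total (bit ∘ P?)) _))
        (+-mono-≤ bound (≤-refl {13})))
      where
      es = HamPath.edges H
      Fresh : Triple n → Fin n → Set
      Fresh T w = Completes T w × ¬ Used T es w
      Fresh? : ∀ T → Decidable (Fresh T)
      Fresh? T w = Completes? T w ×-dec ¬? (Used? T es w)
      -- Excluding `v` makes the two new hyperedges differ: the one chosen at `v` contains `v`,
      -- whereas the one through `T` and `y` could contain `v` only if `y ≡ v`.
      P? : Decidable λ w → Fresh T w × w ≢ v
      P? w = Fresh? T w ×-dec ¬? (w ≟ v)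
      fresh-edge : ∀ {T w} → Fresh T w → ∃ λ e → e ∉ es × (T ⊆ₑ e × w ∈ₑ e) × χ e ≡ κ
      fresh-edge ((w∉T , e , e⊇ , eq) , ¬used) = e , (λ e∈es → ¬used (w∉T , Any.map (λ { refl → e⊇ }) e∈es)) , e⊇ , eq
      outside : ∀ {T u w} → u ∈₃ T → ¬ w ∈₃ T → u ≢ w
      outside u∈T w∉T refl = w∉T u∈T
      bound : suc (total (bit ∘ P?) + total (bit ∘ Fresh? T′)) ≤ n
      bound = [ (λ cycle → contradiction cycle no-cycle) , id ]′
        (crossing H P? (Fresh? T′) (λ (((u∉T , _) , _) , _) → u∉T u∈T) (λ ((v∉T′ , _) , _) → v∉T′ v∈T′) steps)
        where
        steps : ∀ {x y} → Fresh T y × y ≢ v → Fresh T′ x →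
          ∃₂ λ fs gs → Step Q u y fs × Step Q v x gs × Unique (fs ++ gs ++ es)
        steps (fy@((y∉T , _) , _) , y≢v) fx@((x∉T′ , _) , _)
          with e , e∉ , (T⊆e , y∈e) , χe ← fresh-edge {T} fy | f , f∉ , (T′⊆f , x∈f) , χf ← fresh-edge {T′} fx
          = _ , _ , hyper e (outside {T} u∈T y∉T) (⊆ₑ-∈ {T = T} {e} T⊆e u∈T) y∈e χe
          , hyper f (outside {T′} v∈T′ x∉T′) v∈f x∈f χf
          , (e≢f ∷ ¬Any⇒All¬ es e∉) ∷ ¬Any⇒All¬ es f∉ ∷ HamPath.distinct H
          where
          v∈f : v ∈ₑ f
          v∈f = ⊆ₑ-∈ {T = T′} {f} T′⊆f v∈T′
          e≢f : e ≢ f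
          e≢f refl = y≢v (fourth-unique {T = T} {e} T⊆e y∈e v∈f y∉T v∉T)
      codegree-≤R : codegree T′ ≤ total (bit ∘ Fresh? T′) + 6
      codegree-≤R = ≤-trans (total-mono λ w → bit-cover (Completes? T′ w) (Fresh? T′ w) (Used? T′ es w) λ compl →
          case Used? T′ es w of λ { (yes used) → inj₂ used ; (no ¬used) → inj₁ (compl , ¬used) })
        (≤-trans (≤-reflexive (total-+ (bit ∘ Fresh? T′) (bit ∘ Used? T′ es))) (+-monoʳ-≤ _ (used-≤6 T′ H)))
      codegree-≤P : codegree T ≤ total (bit ∘ P?) + 7
      codegree-≤P = ≤-trans (total-mono pointwise) (≤-trans (≤-reflexive (trans
          (total-+ (bit ∘ P?) (λ w → bit (Used? T es w) + bit (w ≟ v)))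
          (cong (total (bit ∘ P?) +_) (total-+ (bit ∘ Used? T es) (λ w → bit (w ≟ v))))))
        (+-monoʳ-≤ _ (+-mono-≤ (used-≤6 T H) (≤-reflexive (total-single v)))))
        where
        pointwise : ∀ w → bit (Completes? T w) ≤ bit (P? w) + (bit (Used? T es w) + bit (w ≟ v))
        pointwise w = ≤-trans (bit-cover (Completes? T w) (P? w) (Used? T es w ⊎-dec (w ≟ v)) λ compl →
            case Used? T es w ,′ (w ≟ v) of λ where
              (yes used , _)     → inj₂ (inj₁ used)
              (_ , yes w≡v)      → inj₂ (inj₂ w≡v)
              (no ¬used , no w≢v) → inj₁ ((compl , ¬used) , w≢v))
          (+-monoʳ-≤ (bit (P? w)) (bit-⊎ (Used? T es w) (w ≟ v)))
      lemma : ∀ p r → suc (p + 7 + (r + 6)) ≡ suc (p + r) + 13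
      lemma = solve-∀

  -- Maximal graphs without a Hamiltonian cycle

  path-mono : ∀ {Q Q′ u v vs es} → (∀ {p} → p ∈ Q → p ∈ Q′) → Path Q u v vs es → Path Q′ u v vs es
  step-mono : ∀ {Q Q′ u v es} → (∀ {p} → p ∈ Q → p ∈ Q′) → Step Q u v es → Step Q′ u v es
  step-mono Q⊆ (hyper e u≢v u∈e v∈e eq) = hyper e u≢v u∈e v∈e eq
  step-mono Q⊆ (free (u≢v , uv))        = free (u≢v , Sum.map Q⊆ Q⊆ uv)
  path-mono Q⊆ [ v ]   = [ v ]
  path-mono Q⊆ (s ∷ p) = step-mono Q⊆ s ∷ path-mono Q⊆ p

  cycle-mono : ∀ {Q Q′} → (∀ {p} → p ∈ Q → p ∈ Q′) → HamCycle Q → HamCycle Q′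
  cycle-mono Q⊆ C = record
    { path = path-mono Q⊆ (HamCycle.path C) ; close = step-mono Q⊆ (HamCycle.close C)
    ; cover = HamCycle.cover C ; distinct = HamCycle.distinct C }

  closed-path : ∀ {Q u vs es} → Path Q u u vs es → Unique vs → length vs ≡ 1
  closed-path [ _ ]   _        = refl
  closed-path (_ ∷ p) (u∉ ∷ _) = contradiction (end∈ p) (All¬⇒¬Any u∉)

  module _ (3≤n : 3 ≤ n) {Q : Graph} (p q : Fin n) where

    Swap : Fin n → Fin n → Set
    Swap x y = (x ≡ p × y ≡ q) ⊎ (x ≡ q × y ≡ p)

    remove-step : ∀ {u v fs} → Step ((p , q) ∷ Q) u v fs → Step Q u v fs ⊎ (fs ≡ [] × Swap u v)
    remove-step (hyper e u≢v u∈e v∈e eq)         = inj₁ (hyper e u≢v u∈e v∈e eq)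
    remove-step (free (_ , inj₁ (here refl)))    = inj₂ (refl , inj₁ (refl , refl))
    remove-step (free (_ , inj₂ (here refl)))    = inj₂ (refl , inj₂ (refl , refl))
    remove-step (free (u≢v , inj₁ (there uv)))   = inj₁ (free (u≢v , inj₁ uv))
    remove-step (free (u≢v , inj₂ (there vu)))   = inj₁ (free (u≢v , inj₂ vu))

    Swap-∈ : ∀ {x u v} → (x ≡ p ⊎ x ≡ q) → Swap u v → x ≡ u ⊎ x ≡ v
    Swap-∈ (inj₁ refl) (inj₁ (refl , refl)) = inj₁ refl
    Swap-∈ (inj₁ refl) (inj₂ (refl , refl)) = inj₂ refl
    Swap-∈ (inj₂ refl) (inj₁ (refl , refl)) = inj₂ refl
    Swap-∈ (inj₂ refl) (inj₂ (refl , refl)) = inj₁ refl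

    -- A step along the new pair would visit both `p` and `q`, hence also `x`.
    avoid : ∀ {x u v vs es} → (x ≡ p ⊎ x ≡ q) → x ∉ vs → Path ((p , q) ∷ Q) u v vs es → Path Q u v vs es
    avoid x∈pq x∉ [ v ] = [ v ]
    avoid x∈pq x∉ (s ∷ r) with remove-step s
    ... | inj₁ s′ = s′ ∷ avoid x∈pq (x∉ ∘ there) r
    ... | inj₂ (_ , swap) with Swap-∈ x∈pq swap
    ...   | inj₁ refl = contradiction (here refl) x∉
    ...   | inj₂ refl = contradiction (there (start∈ r)) x∉

    -- Vertices do not repeat, so the new pair is traversed at most once: after its first use the
    -- rest of the path avoids one of its ends. Cutting there leaves two paths in `Q`.
    remove-path : ∀ {u v vs es} → Path ((p , q) ∷ Q) u v vs es → Unique vs →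
      Path Q u v vs es ⊎
      ∃₂ λ x y → Swap x y × ∃₂ λ vs₁ vs₂ → ∃₂ λ es₁ es₂ →
      Path Q u x vs₁ es₁ × Path Q y v vs₂ es₂ × vs ≡ vs₁ ++ vs₂ × es ≡ es₁ ++ es₂
    remove-path [ v ] _ = inj₁ [ v ]
    remove-path (_∷_ {u} {fs = fs} s r) (u∉ ∷ vs!) with remove-step s
    ... | inj₂ (refl , swap) = inj₂ (_ , _ , swap , _ , _ , _ , _ , [ u ]
                                    , avoid (Sum.map proj₁ proj₁ swap) (All¬⇒¬Any u∉) r , refl , refl)
    ... | inj₁ s′ with remove-path r vs!
    ...   | inj₁ r′ = inj₁ (s′ ∷ r′)
    ...   | inj₂ (x , y , swap , vs₁ , vs₂ , es₁ , es₂ , r₁ , r₂ , refl , refl) =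
      inj₂ (x , y , swap , _ , vs₂ , _ , es₂ , s′ ∷ r₁ , r₂ , refl , sym (++-assoc fs es₁ es₂))

    orient : ∀ {x y} → Swap x y → HamPath Q y x → HamPath Q p q
    orient (inj₁ (refl , refl)) H = reverseHam H
    orient (inj₂ (refl , refl)) H = H

    -- The case in which an inner step and the closing step both use the new pair. Each of the two
    -- pieces then returns to its own starting vertex, so it is a single vertex.
    doubly-closed : ∀ {u v x y vs₁ vs₂ es₁ es₂} → Path Q u x vs₁ es₁ → Path Q y v vs₂ es₂ →
      Unique (vs₁ ++ vs₂) → Swap x y → Swap v u → length (vs₁ ++ vs₂) ≡ 2
    doubly-closed {vs₁ = vs₁} {vs₂} r₁ r₂ vs! xy vu
      with Swap-∈ (Sum.map proj₁ proj₁ xy) vu | Swap-∈ (Sum.swap (Sum.map proj₂ proj₂ xy)) vu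
    ... | inj₁ refl | _         = contradiction (end∈ r₂) (Unique-++⇒disjoint vs₁ vs! (end∈ r₁))
    ... | inj₂ refl | inj₂ refl = contradiction (start∈ r₂) (Unique-++⇒disjoint vs₁ vs! (start∈ r₁))
    ... | inj₂ refl | inj₁ refl = trans (length-++ vs₁)
      (cong₂ _+_ (closed-path r₁ (Unique-++⁻ˡ vs₁ vs!)) (closed-path r₂ (Unique-++⁻ʳ vs₁ vs!)))

    -- On at least three vertices a cycle uses the new pair at most once; opening it there leaves a
    -- Hamiltonian path between `p` and `q`.
    remove-edge : HamCycle ((p , q) ∷ Q) → HamCycle Q ⊎ HamPath Q p q
    remove-edge C
      with remove-step (HamCycle.close C) | remove-path (HamCycle.path C) vs!
      where
      vs! : Unique (HamCycle.vertices C)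
      vs! = Unique-resp-↭ (↭-sym (HamCycle.cover C)) (allFin⁺ n)
    ... | inj₁ s | inj₁ r = inj₁ record { path = r ; close = s ; cover = HamCycle.cover C ; distinct = HamCycle.distinct C }
    ... | inj₂ (refl , swap) | inj₁ r = inj₂ (orient swap record
      { path = r ; cover = HamCycle.cover C ; distinct = HamCycle.distinct C })
    ... | inj₁ s | inj₂ (x , y , swap , vs₁ , vs₂ , es₁ , es₂ , r₁ , r₂ , refl , refl) = inj₂ (orient swap record
      { path     = join r₂ s r₁
      ; cover    = ↭-trans (++-comm vs₂ vs₁) (HamCycle.cover C)
      ; distinct = Unique-resp-↭ (solve 3 (λ f e e′ → (f ⊕ (e ⊕ e′)) ⊜ (e′ ⊕ (f ⊕ e))) ↭-refl fs es₁ es₂) (HamCycle.distinct C)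
      })
      where
      open CommutativeMonoidSolver (++-commutativeMonoid {A = Edge4 n}) using (solve; _⊜_; _⊕_)
      fs = HamCycle.closing C
    ... | inj₂ (refl , swap′) | inj₂ (x , y , swap , vs₁ , vs₂ , es₁ , es₂ , r₁ , r₂ , refl , refl)
      = contradiction (subst (3 ≤_) n≡2 3≤n) λ { (s≤s (s≤s ())) }
      where
      n≡2 : n ≡ 2
      n≡2 = trans (sym (trans (↭-length (HamCycle.cover C)) (length-tabulate {n = n} id)))
        (doubly-closed r₁ r₂ (Unique-resp-↭ (↭-sym (HamCycle.cover C)) (allFin⁺ n)) swap swap′)

  -- Greedy construction: each pair in turn is added unless it creates a cycle. A refused pair also
  -- creates one over the larger final graph, where `remove-edge` then gives the required path. The
  -- double negation permits a case distinction on the existence of a cycle.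
  extend : 3 ≤ n → ∀ pairs {Q} → ¬ HamCycle Q →
    ¬ ¬ (∃ λ Q′ → (∀ {p} → p ∈ Q → p ∈ Q′) × ¬ HamCycle Q′ ×
         (∀ {u v} → (u , v) ∈ pairs → u ≢ v → ¬ Adj Q′ u v → HamPath Q′ u v))
  extend 3≤n [] {Q} ¬C k = k (Q , id , ¬C , λ ())
  extend 3≤n ((p , q) ∷ pairs) {Q} ¬C k = ¬¬-excluded-middle λ where
    (yes C) → extend 3≤n pairs ¬C λ (Q′ , Q⊆ , ¬C′ , joined) → k (Q′ , Q⊆ , ¬C′ , λ where
      (here refl) _ _ → [ (λ C′ → contradiction C′ ¬C′) , id ]′
        (remove-edge 3≤n p q (cycle-mono (λ { (here refl) → here refl ; (there i) → there (Q⊆ i) }) C))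
      (there i)       → joined i)
    (no ¬C₁) → extend 3≤n pairs ¬C₁ λ (Q′ , Q⊆ , ¬C′ , joined) → k (Q′ , Q⊆ ∘ there , ¬C′ , λ where
      (here refl) p≢q ¬pq → contradiction (p≢q , inj₁ (Q⊆ (here refl))) ¬pq
      (there i)           → joined i)

  record Saturated : Set where
    field
      graph    : Graph
      no-cycle : ¬ HamCycle graph
      joined   : ∀ {u v} → u ≢ v → ¬ Adj graph u v → HamPath graph u v

  saturate : 3 ≤ n → ¬ HamCycle [] → ¬ ¬ Saturated
  saturate 3≤n ¬C k = extend 3≤n (cartesianProduct (allFin n) (allFin n)) ¬C λ (Q , _ , ¬C′ , joined) →
    k record { graph = Q ; no-cycle = ¬C′ ; joined = joined (∈-cartesianProduct⁺ (∈-allFin _) (∈-allFin _)) }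

  freePath : ∀ {Q} → (∀ {u v} → u ≢ v → Adj Q u v) → ∀ u us → Unique (u ∷ us) →
             ∃ λ v → v ∈ u ∷ us × Path Q u v (u ∷ us) []
  freePath complete u []       _                  = u , here refl , [ u ]
  freePath complete u (v ∷ us) ((u≢v ∷ _) ∷ us!) with w , w∈ , p ← freePath complete v us us! =
    w , there w∈ , free (complete u≢v) ∷ p

  complete⇒cycle : 2 ≤ n → ∀ {Q} → (∀ {u v} → u ≢ v → Adj Q u v) → HamCycle Q
  complete⇒cycle (s≤s (s≤s _)) complete with allFin⁺ n
  ... | 0∉ ∷ us! with w , w∈ , p ← freePath complete _ _ us! = record
    { path     = free (complete (All.head 0∉)) ∷ p
    ; close    = free (complete λ { refl → All¬⇒¬Any 0∉ w∈ })
    ; cover    = ↭-refl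
    ; distinct = []
    }

-- Missing pairs

module Rainbow {n : ℕ} (85≤n : 85 ≤ n) (χ : Edge4 n → Fin 3) (saturated : ∀ κ → Berge.Saturated χ κ) where

  open module Colour κ = Berge χ κ using (Adj; Adj?; Adj-sym; HamPath; Completes; Completes?; codegree; degree)
  open module Sat κ = Berge.Saturated (saturated κ) using (graph; no-cycle; joined)

  2≤n : 2 ≤ n
  2≤n = ≤-trans (s≤s (s≤s z≤n)) 85≤n

  Missing : Fin 3 → Fin n → Fin n → Set
  Missing κ u v = u ≢ v × ¬ Adj κ (graph κ) u v

  Missing? : ∀ κ u → Decidable (Missing κ u)
  Missing? κ u v = ¬? (u ≟ v) ×-dec ¬? (Adj? κ (graph κ) u v)

  Missing-sym : ∀ {κ u v} → Missing κ u v → Missing κ v u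
  Missing-sym {κ} (u≢v , ¬uv) = ≢-sym u≢v , ¬uv ∘ Adj-sym κ

  missing-path : ∀ {κ u v} → Missing κ u v → HamPath κ (graph κ) u v
  missing-path {κ} (u≢v , ¬uv) = joined κ u≢v ¬uv

  -- A complete graph would have a Hamiltonian cycle of free edges alone.
  missing-edge : ∀ κ → ∃₂ (Missing κ)
  missing-edge κ = decidable-stable (any? λ u → any? (Missing? κ u)) λ none →
    no-cycle κ (Berge.complete⇒cycle χ κ 2≤n λ {u} {v} u≢v →
      decidable-stable (Adj? κ (graph κ) u v) λ ¬uv → none (u , v , u≢v , ¬uv))

  missing-degree : Fin 3 → Fin n → ℕ
  missing-degree κ u = total (bit ∘ Missing? κ u)

  total-1 : total {n} (λ _ → 1) ≡ n
  total-1 = trans (total-const n 1) (*-identityʳ n)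

  degrees : ∀ κ u → n ≤ degree κ (graph κ) u + (missing-degree κ u + 1)
  degrees κ u = ≤-trans (≤-reflexive (sym total-1)) (≤-trans (total-mono pointwise) (≤-reflexive
    (trans (total-+ (bit ∘ A?) (λ v → bit (M? v) + bit (v ≟ u)))
      (cong (total (bit ∘ A?) +_) (trans (total-+ (bit ∘ M?) (λ v → bit (v ≟ u)))
        (cong (total (bit ∘ M?) +_) (total-single u)))))))
    where
    A? = Adj? κ (graph κ) u
    M? = Missing? κ u
    pointwise : ∀ v → 1 ≤ bit (A? v) + (bit (M? v) + bit (v ≟ u))
    pointwise v = ≤-trans (1≤bit+bit (A? v) (M? v ⊎-dec (v ≟ u)) covered) (+-monoʳ-≤ (bit (A? v)) (bit-⊎ (M? v) (v ≟ u)))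
      where
      covered : Adj κ (graph κ) u v ⊎ Missing κ u v ⊎ v ≡ u
      covered with A? v | v ≟ u
      ... | yes uv | _       = inj₁ uv
      ... | no _   | yes v≡u = inj₂ (inj₂ v≡u)
      ... | no ¬uv | no v≢u  = inj₂ (inj₁ (≢-sym v≢u , ¬uv))

  -- The complementary form of `degree-sum`; equal terms are added on both sides to avoid
  -- subtraction.
  missing-degree-sum : ∀ {κ u v} → Missing κ u v → n ≤ missing-degree κ u + missing-degree κ v + 1
  missing-degree-sum {κ} {u} {v} m = +-cancelʳ-≤ (n + (D u + D v) + 1) n (M u + M v + 1)
    (≤-trans (≤-reflexive (lhs n (D u) (D v)))
    (≤-trans (+-mono-≤ (+-mono-≤ (degrees κ u) (degrees κ v)) (Berge.degree-sum χ κ (no-cycle κ) (missing-path m)))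
    (≤-reflexive (rhs n (D u) (D v) (M u) (M v)))))
    where
    D = degree κ (graph κ)
    M = missing-degree κ
    lhs : ∀ n d e → n + (n + (d + e) + 1) ≡ n + n + suc (d + e)
    lhs = solve-∀
    rhs : ∀ n d e m m′ → d + (m + 1) + (e + (m′ + 1)) + n ≡ m + m′ + 1 + (n + (d + e) + 1)
    rhs = solve-∀

  -- Saying that three colours exhaust `Fin 3`, rather than fixing them, makes each lemma below
  -- applicable under every permutation of the colours.
  Covers : (i j k : Fin 3) → Set
  Covers i j k = ∀ κ → κ ≡ i ⊎ κ ≡ j ⊎ κ ≡ k

  rotate : ∀ {i j k} → Covers i j k → Covers j k i
  rotate cov κ = Sum.assocʳ (Sum.swap (cov κ))

  exchange : ∀ {i j k} → Covers i j k → Covers j i k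
  exchange cov κ with cov κ
  ... | inj₁ p        = inj₂ (inj₁ p)
  ... | inj₂ (inj₁ p) = inj₁ p
  ... | inj₂ (inj₂ p) = inj₂ (inj₂ p)

  -- Each vertex outside `T` extends it to a hyperedge of one of the three colours; the 3 counts the
  -- vertices of `T` itself.
  codegrees : ∀ {i j k} → Covers i j k → ∀ T → n ≤ codegree i T + (codegree j T + (codegree k T + 3))
  codegrees {i} {j} {k} cov T = ≤-trans (≤-reflexive (sym total-1)) (≤-trans (total-mono pointwise) (≤-trans (≤-reflexive
      (trans (total-+ I (λ w → J w + (K w + τ w))) (cong (total I +_) (trans (total-+ J (λ w → K w + τ w))
        (cong (total J +_) (total-+ K τ))))))
      (+-monoʳ-≤ (total I) (+-monoʳ-≤ (total J) (+-monoʳ-≤ (total K) (total-triple T))))))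
    where
    I = bit ∘ Completes? i T
    J = bit ∘ Completes? j T
    K = bit ∘ Completes? k T
    τ = λ w → bit (w ∈₃? T)
    pointwise : ∀ w → 1 ≤ I w + (J w + (K w + τ w))
    pointwise w = ≤-trans (1≤bit+bit (Completes? i T w) (Completes? j T w ⊎-dec (Completes? k T w ⊎-dec (w ∈₃? T))) covered)
      (+-monoʳ-≤ (I w) (≤-trans (bit-⊎ (Completes? j T w) (Completes? k T w ⊎-dec (w ∈₃? T)))
        (+-monoʳ-≤ (J w) (bit-⊎ (Completes? k T w) (w ∈₃? T)))))
      where
      covered : Completes i T w ⊎ Completes j T w ⊎ Completes k T w ⊎ w ∈₃ T
      covered with w ∈₃? T
      ... | yes w∈T = inj₂ (inj₂ (inj₂ w∈T))
      ... | no w∉T with e , e⊇ ← edge-through T w∉T with cov (χ e)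
      ...   | inj₁ eq        = inj₁ (w∉T , e , e⊇ , eq)
      ...   | inj₂ (inj₁ eq) = inj₂ (inj₁ (w∉T , e , e⊇ , eq))
      ...   | inj₂ (inj₂ eq) = inj₂ (inj₂ (inj₁ (w∉T , e , e⊇ , eq)))

  Inside : Fin 3 → Triple n → Set
  Inside κ T = ∃₂ λ u v → Missing κ u v × u ∈₃ T × v ∈₃ T

  inside-≤6 : ∀ {κ T} → Inside κ T → codegree κ T ≤ 6
  inside-≤6 {κ} {T} (u , v , m , u∈T , v∈T) =
    Berge.codegree-inside χ κ (no-cycle κ) {T = T} (missing-path m) (proj₁ m) u∈T v∈T

  cross : ∀ {κ u v T T′} → Missing κ u v → u ∈₃ T → ¬ v ∈₃ T → v ∈₃ T′ → suc (codegree κ T + codegree κ T′) ≤ n + 13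
  cross {κ} {T = T} {T′} m = Berge.codegree-sum χ κ (no-cycle κ) {T = T} {T′} (missing-path m)

  -- T′ completes almost only in colour k, so v is joined to almost everything in
  -- that colour and u, which a Hamiltonian path joins to v, to hardly anything.
  cross-≤27 : ∀ {i j k u v T T′} → Covers i j k → Inside i T′ → Inside j T′ →
              Missing k u v → u ∈₃ T → ¬ v ∈₃ T → v ∈₃ T′ → codegree k T ≤ 27
  cross-≤27 {i} {j} {k} {u} {v} {T} {T′} cov mi mj mk u∈T v∉T v∈T′ = +-cancelʳ-≤ (suc n + codegree k T′) (codegree k T) 27
    -- In colour `k` the codegree of `T′` is at least `n - 15`, and the two codegrees add up to at
    -- most `n + 12`; this leaves 27 for `T`.
    (≤-trans (≤-reflexive (lhs n (codegree k T) (codegree k T′)))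
    (≤-trans (+-mono-≤ (cross {k} {u} {v} {T} {T′} mk u∈T v∉T v∈T′) (≤-trans (codegrees cov T′)
       (+-mono-≤ (inside-≤6 {i} {T′} mi) (+-mono-≤ (inside-≤6 {j} {T′} mj) (≤-refl {codegree k T′ + 3})))))
    (≤-reflexive (rhs n (codegree k T′)))))
    where
    lhs : ∀ n t t′ → t + (suc n + t′) ≡ suc (t + t′) + n
    lhs = solve-∀
    rhs : ∀ n t′ → n + 13 + (6 + (6 + (t′ + 3))) ≡ 27 + (suc n + t′)
    rhs = solve-∀

  -- Forbidden configurations of missing pairs

  -- All three codegrees of `T` would be at most 6, forcing `n` to be at most 21.
  no-rainbow-inside : ∀ {i j k} → Covers i j k → ∀ T → Inside i T → Inside j T → Inside k T → ⊥
  no-rainbow-inside {i} {j} {k} cov T mi mj mk = too-big 63 (≤-trans 85≤n (≤-trans (codegrees cov T)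
    (+-mono-≤ (inside-≤6 {i} {T} mi) (+-mono-≤ (inside-≤6 {j} {T} mj) (+-mono-≤ (inside-≤6 {k} {T} mk) (≤-refl {3})))))) refl

  third-vertex : (u v : Fin n) → ∃ λ w → w ≢ u × w ≢ v
  third-vertex u v = decidable-stable (any? λ w → ¬? (w ≟ u) ×-dec ¬? (w ≟ v)) λ none →
    too-big 82 (≤-trans 85≤n (≤-trans (≤-reflexive (sym total-1)) (≤-trans (total-mono λ w → pointwise none w)
      (≤-reflexive (trans (total-+ (λ w → bit (w ≟ u)) (λ w → bit (w ≟ v))) (cong₂ _+_ (total-single u) (total-single v))))))) refl
    where
    pointwise : ¬ (∃ λ w → w ≢ u × w ≢ v) → ∀ w → 1 ≤ bit (w ≟ u) + bit (w ≟ v)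
    pointwise none w = 1≤bit+bit (w ≟ u) (w ≟ v) (case (w ≟ u) ,′ (w ≟ v) of λ where
      (yes p , _)     → inj₁ p
      (no _ , yes q)  → inj₂ q
      (no ¬p , no ¬q) → contradiction (w , ¬p , ¬q) none)

  -- Every triple `u v w` has codegree at least `n - 15` in colour `k`. Take a pair missing in
  -- colour `k`. If it meets `u` or `v`, it lies inside such a triple, against `no-rainbow-inside`;
  -- otherwise crossing over it with the triples `u v z` and `u v z′` gives `n` at most 42.
  doubly-missing : ∀ {i j k u v} → Covers i j k → Missing i u v → Missing j u v → ⊥
  doubly-missing {i} {j} {k} {u} {v} cov mi@(u≢v , _) mj =
    let z , z′ , mk = missing-edge k in conclude mk (pair? z) (pair? z′)
    where
    pair? : ∀ w → Dec (w ≡ u ⊎ w ≡ v)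
    pair? w = (w ≟ u) ⊎-dec (w ≟ v)

    with-third : ∀ {w} → ¬ (w ≡ u ⊎ w ≡ v) → Triple n
    with-third w∉ = triple u≢v (w∉ ∘ inj₁ ∘ sym) (w∉ ∘ inj₂ ∘ sym)

    k-completes : ∀ {w} (w∉ : ¬ (w ≡ u ⊎ w ≡ v)) → n ≤ 6 + (6 + (codegree k (with-third w∉) + 3))
    k-completes w∉ = ≤-trans (codegrees cov (with-third w∉))
      (+-mono-≤ (inside-≤6 {i} {with-third w∉} (u , v , mi , inj₁ refl , inj₂ (inj₁ refl)))
      (+-mono-≤ (inside-≤6 {j} {with-third w∉} (u , v , mj , inj₁ refl , inj₂ (inj₁ refl))) ≤-refl))

    not-inside : ∀ {w} (w∉ : ¬ (w ≡ u ⊎ w ≡ v)) → ¬ Inside k (with-third w∉)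
    not-inside w∉ = no-rainbow-inside cov (with-third w∉)
      (u , v , mi , inj₁ refl , inj₂ (inj₁ refl)) (u , v , mj , inj₁ refl , inj₂ (inj₁ refl))

    arith : ∀ n a b → suc (a + b) + ((n + n) + 85) ≡ suc (n + 13 + ((6 + (6 + (a + 3)) + (6 + (6 + (b + 3)))) + n) + 42)
    arith = solve-∀

    conclude : ∀ {z z′} → Missing k z z′ → Dec (z ≡ u ⊎ z ≡ v) → Dec (z′ ≡ u ⊎ z′ ≡ v) → ⊥
    conclude mk (yes z∈) (yes z′∈) = let w , w≢u , w≢v = third-vertex u v in
      not-inside [ w≢u , w≢v ]′ (_ , _ , mk , Sum.map₂ inj₁ z∈ , Sum.map₂ inj₁ z′∈)
    conclude mk (yes z∈) (no z′∉)  = not-inside z′∉ (_ , _ , mk , Sum.map₂ inj₁ z∈ , inj₂ (inj₂ refl))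
    conclude mk (no z∉)  (yes z′∈) = not-inside z∉ (_ , _ , mk , inj₂ (inj₂ refl) , Sum.map₂ inj₁ z′∈)
    conclude {z} {z′} mk (no z∉) (no z′∉) = too-big 42
      (+-mono-≤ (cross {k} {T = with-third z∉} {with-third z′∉} mk (inj₂ (inj₂ refl))
                  ([ z′∉ ∘ inj₁ , [ z′∉ ∘ inj₂ , proj₁ mk ∘ sym ]′ ]′) (inj₂ (inj₂ refl)))
        (+-mono-≤ (+-mono-≤ (k-completes z∉) (k-completes z′∉)) 85≤n))
      (arith n (codegree k (with-third z∉)) (codegree k (with-third z′∉)))

  separate : ∀ {i j k u v w} → Covers i j k → Missing i u v → Missing j u w → v ≢ w
  separate cov mi mj refl = doubly-missing cov mi mj

  -- The leaves form a triple `T`, distinct because no pair is missing in two colours. For each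
  -- colour, the centre and the leaves of the other two colours form a triple to which `cross-≤27`
  -- applies. Hence all codegrees of `T` are at most 27 and `n` is at most 84, so the bound 85 is
  -- just enough.
  no-rainbow-star : ∀ {i j k w x y z} → Covers i j k → Missing i w x → Missing j w y → Missing k w z → ⊥
  no-rainbow-star {i} {j} {k} {w} {x} {y} {z} cov mi mj mk = too-big 0 (≤-trans 85≤n (≤-trans (codegrees cov T)
      (+-mono-≤ (bound (rotate cov) (triple y≢z (≢w mj) (≢w mk)) mj mk mi
        (inj₁ refl) (inj₁ refl) (inj₂ (inj₁ refl)) (inj₂ (inj₂ refl)))
      (+-mono-≤ (bound (rotate (rotate cov)) (triple x≢z (≢w mi) (≢w mk)) mk mi mj
        (inj₂ (inj₁ refl)) (inj₂ (inj₁ refl)) (inj₁ refl) (inj₂ (inj₂ refl)))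
      (+-mono-≤ (bound cov (triple x≢y (≢w mi) (≢w mj)) mi mj mk
        (inj₂ (inj₂ refl)) (inj₁ refl) (inj₂ (inj₁ refl)) (inj₂ (inj₂ refl)))
        (≤-refl {3})))))) refl
    where
    x≢y = separate cov mi mj
    y≢z = separate (rotate cov) mj mk
    x≢z = ≢-sym (separate (rotate (rotate cov)) mk mi)
    T = triple x≢y x≢z y≢z
    ≢w : ∀ {κ v} → Missing κ w v → v ≢ w
    ≢w = ≢-sym ∘ proj₁
    w∉T : ¬ w ∈₃ T
    w∉T = [ proj₁ mi , [ proj₁ mj , proj₁ mk ]′ ]′
    bound : ∀ {i j k x y z} → Covers i j k → ∀ T′ → Missing i w x → Missing j w y → Missing k w z →
            z ∈₃ T → x ∈₃ T′ → y ∈₃ T′ → w ∈₃ T′ → codegree k T ≤ 27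
    bound cov T′ mi mj mk z∈T x∈ y∈ w∈ = cross-≤27 {T = T} {T′} cov (_ , _ , mi , w∈ , x∈) (_ , _ , mj , w∈ , y∈)
      (Missing-sym mk) z∈T w∉T w∈

  -- If the ends coincide, the pairs form a triangle. Otherwise the triples `x y p` and `x y q` each
  -- have codegree at most 6 in one of the colours `i`, `j` and at most 27 in the other, so at least
  -- `n - 36` in colour `k`. Crossing over the pair `p q` then gives `n` at most 84.
  no-rainbow-path : ∀ {i j k x p q y} → Covers i j k → Missing i x p → Missing k p q → Missing j q y → ⊥
  no-rainbow-path {i} {j} {k} {x} {p} {q} {y} cov mi mk mj = conclude (x ≟ y)
    where
    x≢p = proj₁ mi
    p≢q = proj₁ mk
    q≢y = proj₁ mj
    x≢q = separate (exchange (rotate (rotate cov))) (Missing-sym mi) mk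
    p≢y = separate (exchange (rotate cov)) (Missing-sym mk) mj

    arith : ∀ n a b → suc (a + b) + ((n + n) + 85) ≡ suc (n + 13 + ((6 + (27 + (a + 3)) + (27 + (6 + (b + 3)))) + n) + 0)
    arith = solve-∀

    conclude : Dec (x ≡ y) → ⊥
    conclude (yes refl) = no-rainbow-inside cov (triple x≢p x≢q p≢q)
      (_ , _ , mi , inj₁ refl , inj₂ (inj₁ refl))
      (_ , _ , mj , inj₂ (inj₂ refl) , inj₁ refl)
      (_ , _ , mk , inj₂ (inj₁ refl) , inj₂ (inj₂ refl))
    conclude (no x≢y) = too-big 0
      (+-mono-≤ (cross {k} {T = Tp} {Tq} mk (inj₂ (inj₂ refl)) [ ≢-sym x≢q , [ q≢y , ≢-sym p≢q ]′ ]′ (inj₂ (inj₂ refl)))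
        (+-mono-≤ (+-mono-≤
          (≤-trans (codegrees cov Tp)
            (+-mono-≤ (inside-≤6 {i} {Tp} (_ , _ , mi , inj₁ refl , inj₂ (inj₂ refl))) (+-mono-≤ j-≤27 ≤-refl)))
          (≤-trans (codegrees cov Tq)
            (+-mono-≤ i-≤27 (+-mono-≤ (inside-≤6 {j} {Tq} (_ , _ , mj , inj₂ (inj₂ refl) , inj₂ (inj₁ refl))) ≤-refl))))
          85≤n))
      (arith n (codegree k Tp) (codegree k Tq))
      where
      Tp = triple x≢y x≢p (≢-sym p≢y)
      Tq = triple x≢y x≢q (≢-sym q≢y)
      -- The triple `x p q` contains pairs missing in colours `i` and `k`, so the pair `q y` missing
      -- in colour `j` limits every triple through `y` that avoids `q`. The next bound is its mirror
      -- image.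
      j-≤27 : codegree j Tp ≤ 27
      j-≤27 = cross-≤27 {T = Tp} {triple x≢p x≢q p≢q} (exchange (rotate (rotate cov)))
        (_ , _ , mi , inj₁ refl , inj₂ (inj₁ refl)) (_ , _ , mk , inj₂ (inj₁ refl) , inj₂ (inj₂ refl))
        (Missing-sym mj) (inj₂ (inj₁ refl)) [ ≢-sym x≢q , [ q≢y , ≢-sym p≢q ]′ ]′ (inj₂ (inj₂ refl))
      i-≤27 : codegree i Tq ≤ 27
      i-≤27 = cross-≤27 {T = Tq} {triple p≢q p≢y q≢y} (rotate cov)
        (_ , _ , mj , inj₂ (inj₁ refl) , inj₂ (inj₂ refl)) (_ , _ , mk , inj₁ refl , inj₂ (inj₁ refl))
        mi (inj₁ refl) [ ≢-sym x≢p , [ p≢y , p≢q ]′ ]′ (inj₁ refl)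

  -- Counting vertices on missing pairs

  Touched : Fin 3 → Fin n → Set
  Touched κ u = ∃ (Missing κ u)

  Touched? : ∀ κ → Decidable (Touched κ)
  Touched? κ u = any? (Missing? κ u)

  touched : Fin 3 → ℕ
  touched κ = total (bit ∘ Touched? κ)

  -- Of the two ends of a missing pair, take the one of larger missing degree `d`, so that
  -- `2 * d + 1` is at least `n`. This vertex and its `d` missing neighbours are all touched.
  touched-large : ∀ κ → suc n ≤ 2 * touched κ
  touched-large κ with u , v , m ← missing-edge κ =
    [ large (Missing-sym m) , large m ]′ (≤-total (missing-degree κ u) (missing-degree κ v))
    where
    neighbourhood : ∀ {u v} → Missing κ u v → missing-degree κ u + 1 ≤ touched κ
    neighbourhood {u} {v} m = ≤-trans (≤-reflexive (trans (cong (missing-degree κ u +_) (sym (total-single u)))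
        (sym (total-+ (bit ∘ Missing? κ u) (λ w → bit (w ≟ u)))))) (total-mono pointwise)
      where
      pointwise : ∀ w → bit (Missing? κ u w) + bit (w ≟ u) ≤ bit (Touched? κ w)
      pointwise w = bit-disjoint (Missing? κ u w) (w ≟ u) (Touched? κ w) (≢-sym ∘ proj₁)
        λ { (inj₁ m′) → u , Missing-sym m′ ; (inj₂ refl) → v , m }
    large : ∀ {u v} → Missing κ u v → missing-degree κ v ≤ missing-degree κ u → suc n ≤ 2 * touched κ
    large {u} {v} m le = ≤-trans (s≤s (missing-degree-sum m))
      (≤-trans (s≤s (+-mono-≤ (+-monoʳ-≤ (missing-degree κ u) le) (≤-refl {1})))
      (≤-trans (≤-reflexive (arith (missing-degree κ u))) (*-monoʳ-≤ 2 (neighbourhood m))))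
      where
      arith : ∀ d → suc (d + d + 1) ≡ 2 * (d + 1)
      arith = solve-∀

  -- Two counts, one around `v` and one around `p` and `q`, bound the four missing degrees plus
  -- twice `touched k` by `3 * n - 2`. The pairs `v p` and `v q` contribute at least `2 * n - 2` to
  -- the degrees, leaving at most `n` for `2 * touched k`, against `touched-large`.
  touched-twice : ∀ {i j k v} → Covers i j k → Touched i v → Touched j v → ⊥
  touched-twice {i} {j} {k} {v} cov (p , mi) (q , mj) = too-big 0
    (+-mono-≤ at-v (+-mono-≤ at-p-q (+-mono-≤ (missing-degree-sum mi) (+-mono-≤ (missing-degree-sum mj) (touched-large k)))))
    (arith n (touched k) (missing-degree i v) (missing-degree j v) (missing-degree i p) (missing-degree j q))
    where
    arith : ∀ n t a b c d → a + (b + (1 + t)) + (c + (d + (t + 1)) + (n + (n + suc n))) ≡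
                            suc (n + (n * 2 + (a + c + 1 + (b + d + 1 + 2 * t))) + 0)
    arith = solve-∀

    i-neighbour : ∀ {w} → Missing i v w → ¬ Touched k w
    i-neighbour m (_ , mk) = no-rainbow-path (rotate cov) (Missing-sym mj) m mk

    j-neighbour : ∀ {w} → Missing j v w → ¬ Touched k w
    j-neighbour m (_ , mk) = no-rainbow-path (exchange (rotate (rotate cov))) (Missing-sym mi) m mk

    -- The `i`-neighbours and `j`-neighbours of `v`, `v` itself and the vertices touched in colour
    -- `k` are pairwise disjoint: a common vertex would give a doubly missing pair, a rainbow path
    -- or a rainbow star.
    at-v : missing-degree i v + (missing-degree j v + (1 + touched k)) ≤ n
    at-v = ≤-trans (≤-reflexive (sym (trans (total-+ I (λ w → J w + (E w + K w))) (cong (total I +_)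
             (trans (total-+ J (λ w → E w + K w)) (cong (total J +_)
               (trans (total-+ E K) (cong (_+ total K) (total-single v)))))))))
           (≤-trans (total-mono pointwise) (≤-reflexive total-1))
      where
      I = bit ∘ Missing? i v
      J = bit ∘ Missing? j v
      E = λ w → bit (w ≟ v)
      K = bit ∘ Touched? k
      pointwise : ∀ w → I w + (J w + (E w + K w)) ≤ 1
      pointwise w =
        bit+-≤ (Missing? i v w)
          (bit+-≤ (Missing? j v w)
            (bit+-≤ (w ≟ v) (bit≤1 (Touched? k w)) λ { refl → bit≤0 (Touched? k w) λ (_ , mk) → no-rainbow-star cov mi mj mk })
            λ m → +-mono-≤ (bit≤0 (w ≟ v) (≢-sym (proj₁ m))) (bit≤0 (Touched? k w) (j-neighbour m)))
          λ m → +-mono-≤ (bit≤0 (Missing? j v w) (doubly-missing cov m))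
                  (+-mono-≤ (bit≤0 (w ≟ v) (≢-sym (proj₁ m))) (bit≤0 (Touched? k w) (i-neighbour m)))

    -- No vertex is counted more than twice: a common neighbour of `p` in colour `i` and `q` in
    -- colour `j` that is touched in colour `k` would be the centre of a rainbow star, and `p`, an
    -- `i`-neighbour of `v`, is not touched in colour `k`.
    at-p-q : missing-degree i p + (missing-degree j q + (touched k + 1)) ≤ n * 2
    at-p-q = ≤-trans (≤-reflexive (sym (trans (total-+ I (λ w → J w + (K w + E w))) (cong (total I +_)
               (trans (total-+ J (λ w → K w + E w)) (cong (total J +_)
                 (trans (total-+ K E) (cong (total K +_) (total-single p)))))))))
             (≤-trans (total-mono pointwise) (≤-reflexive (total-const n 2)))
      where
      I = bit ∘ Missing? i p
      J = bit ∘ Missing? j q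
      E = λ w → bit (w ≟ p)
      K = bit ∘ Touched? k
      K+E≤1 : ∀ w → K w + E w ≤ 1
      K+E≤1 w = bit+-≤ (Touched? k w) (bit≤1 (w ≟ p)) λ tk → bit≤0 (w ≟ p) λ { refl → i-neighbour mi tk }
      pointwise : ∀ w → I w + (J w + (K w + E w)) ≤ 2
      pointwise w =
        bit+-≤ (Missing? i p w) (+-mono-≤ (bit≤1 (Missing? j q w)) (K+E≤1 w)) λ m →
          bit+-≤ (Missing? j q w) (K+E≤1 w) λ m′ →
            +-mono-≤ (bit≤0 (Touched? k w) λ (_ , mk) → no-rainbow-star cov (Missing-sym m) (Missing-sym m′) mk)
                     (bit≤0 (w ≟ p) (≢-sym (proj₁ m)))

  contradictory : ⊥
  contradictory = too-big 1 (+-mono-≤ (+-mono-≤ (touched-large i) (touched-large j)) (*-monoʳ-≤ 2 disjoint))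
    (arith n (touched i) (touched j))
    where
    i j k : Fin 3
    i = zero
    j = suc zero
    k = suc (suc zero)
    cov : Covers i j k
    cov zero             = inj₁ refl
    cov (suc zero)       = inj₂ (inj₁ refl)
    cov (suc (suc zero)) = inj₂ (inj₂ refl)
    disjoint : touched i + touched j ≤ n
    disjoint = ≤-trans (≤-reflexive (sym (total-+ (bit ∘ Touched? i) (bit ∘ Touched? j)))) (≤-trans (total-mono λ w →
        bit+-≤ (Touched? i w) (bit≤1 (Touched? j w)) λ ti → bit≤0 (Touched? j w) (touched-twice cov ti)) (≤-reflexive total-1))
    arith : ∀ n a b → suc n + suc n + 2 * (a + b) ≡ suc (2 * a + 2 * b + 2 * n + 1)
    arith = solve-∀

-- Cyclic sequences and decidability

module _ {A : Set} where

  -- The default value at index `length xs` later serves to close a list into a cyclic sequence.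
  nth : A → List A → ℕ → A
  nth d []       _       = d
  nth d (x ∷ xs) zero    = x
  nth d (x ∷ xs) (suc i) = nth d xs i

  nth-length : ∀ d xs → nth d xs (length xs) ≡ d
  nth-length d []       = refl
  nth-length d (x ∷ xs) = nth-length d xs

  nth-∈ : ∀ {d xs i} → i < length xs → nth d xs i ∈ xs
  nth-∈ {xs = x ∷ xs} {zero}  _          = here refl
  nth-∈ {xs = x ∷ xs} {suc i} (s≤s i<) = there (nth-∈ i<)

  ∈-nth : ∀ {d x xs} → x ∈ xs → ∃ λ i → i < length xs × nth d xs i ≡ x
  ∈-nth (here refl) = zero , s≤s z≤n , refl
  ∈-nth (there x∈)  = let i , i< , eq = ∈-nth x∈ in suc i , s≤s i< , eq

  nth-injective : ∀ {d xs i j} → Unique xs → i < length xs → j < length xs → nth d xs i ≡ nth d xs j → i ≡ j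
  nth-injective {xs = x ∷ xs} {zero}  {zero}  _          _        _        _  = refl
  nth-injective {xs = x ∷ xs} {zero}  {suc j} (x∉ ∷ _)   _        (s≤s j<) eq =
    contradiction (subst (_∈ xs) (sym eq) (nth-∈ j<)) (All¬⇒¬Any x∉)
  nth-injective {xs = x ∷ xs} {suc i} {zero}  (x∉ ∷ _)   (s≤s i<) _        eq =
    contradiction (subst (_∈ xs) eq (nth-∈ i<)) (All¬⇒¬Any x∉)
  nth-injective {xs = x ∷ xs} {suc i} {suc j} (_ ∷ xs!)  (s≤s i<) (s≤s j<) eq =
    cong suc (nth-injective xs! i< j< eq)

  nth-injective-default : ∀ {d xs i j} → Unique (d ∷ xs) → i ≤ length xs → j ≤ length xs →
                          nth d xs i ≡ nth d xs j → i ≡ j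
  nth-injective-default {d} {xs} {i} {j} (d∉ ∷ xs!) i≤ j≤ eq with m≤n⇒m<n∨m≡n i≤ | m≤n⇒m<n∨m≡n j≤
  ... | inj₁ i<   | inj₁ j<   = nth-injective xs! i< j< eq
  ... | inj₁ i<   | inj₂ refl = contradiction (subst (_∈ xs) (trans eq (nth-length d xs)) (nth-∈ i<)) (All¬⇒¬Any d∉)
  ... | inj₂ refl | inj₁ j<   = contradiction (subst (_∈ xs) (trans (sym eq) (nth-length d xs)) (nth-∈ j<)) (All¬⇒¬Any d∉)
  ... | inj₂ refl | inj₂ refl = refl

module _ {n k : ℕ} (χ : Edge4 n → Fin k) {κ : Fin k} where

  open Berge χ κ

  -- With s as the default vertex and f as the default edge, the successor of the
  -- last vertex of the path is s, and the edge leaving that vertex is f.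
  module _ {s f} (s∈f : s ∈ₑ f) (χf≡κ : χ f ≡ κ) where

    nth-start : ∀ {u v vs es} → Path [] u v vs es → nth s vs 0 ≡ u
    nth-start [ _ ]   = refl
    nth-start (_ ∷ _) = refl

    nth-steps : ∀ {u v vs es} → Path [] u v vs es → v ∈ₑ f → ∀ {i} → i < length vs →
      nth s vs i ∈ₑ nth f es i × nth s vs (suc i) ∈ₑ nth f es i × χ (nth f es i) ≡ κ
    nth-steps [ v ] v∈f {zero} _ = v∈f , s∈f , χf≡κ
    nth-steps [ v ] v∈f {suc i} (s≤s ())
    nth-steps (free (_ , inj₁ ()) ∷ p)
    nth-steps (free (_ , inj₂ ()) ∷ p)
    nth-steps (hyper e _ u∈e w∈e eq ∷ p) v∈f {zero} _ = u∈e , subst (_∈ₑ e) (sym (nth-start p)) w∈e , eq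
    nth-steps (hyper e _ _ _ _ ∷ p) v∈f {suc i} (s≤s i<) = nth-steps p v∈f i<

  length-edges : ∀ {u v vs es} → Path [] u v vs es → length vs ≡ suc (length es)
  length-edges [ _ ]                     = refl
  length-edges (free (_ , inj₁ ()) ∷ p)
  length-edges (free (_ , inj₂ ()) ∷ p)
  length-edges (hyper _ _ _ _ _ ∷ p)     = cong suc (length-edges p)

  -- Over the empty graph every step, including the closing one, uses exactly one hyperedge, so the
  -- two lists can be read off as core sequence and edges.
  cycle⇒mono : .{{_ : NonZero n}} → HamCycle [] → MonoHamBergeCycle n χ
  cycle⇒mono record { close = free (_ , inj₁ ()) }
  cycle⇒mono record { close = free (_ , inj₂ ()) }
  cycle⇒mono record
    { start = s ; vertices = vs ; edges = es ; path = p ; close = hyper f _ t∈f s∈f χf≡κ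
    ; cover = cover ; distinct = fes! } =
    v , e , κ , (v-injective , v-surjective) , e-injective , steps
    where
    length-vs : length vs ≡ n
    length-vs = trans (↭-length cover) (length-tabulate {n = n} id)

    v : Fin n → Fin n
    v j = nth s vs (toℕ j)

    e : Fin n → Edge4 n
    -- The list `es` has `n - 1` entries, so the last index receives the closing hyperedge `f`.
    e j = nth f es (toℕ j)

    in-range : (j : Fin n) → toℕ j < length vs
    in-range j = subst (toℕ j <_) (sym length-vs) (toℕ<n j)

    v-injective : Injective _≡_ _≡_ v
    v-injective {i} {j} eq = toℕ-injective
      (nth-injective (Unique-resp-↭ (↭-sym cover) (allFin⁺ n)) (in-range i) (in-range j) eq)

    v-surjective : Surjective _≡_ _≡_ v
    v-surjective y with i , i< , eq ← ∈-nth {d = s} (∈-resp-↭ (↭-sym cover) (∈-allFin y)) =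
      fromℕ< i<n , λ { refl → trans (cong (nth s vs) (toℕ-fromℕ< i<n)) eq }
      where
      i<n : i < n
      i<n = subst (i <_) length-vs i<

    e-injective : Injective _≡_ _≡_ e
    e-injective {i} {j} eq = toℕ-injective (nth-injective-default fes! (below i) (below j) eq)
      where
      below : (j : Fin n) → toℕ j ≤ length es
      below j with s≤s j≤ ← subst (toℕ j <_) (length-edges p) (in-range j) = j≤

    v-next : ∀ j → v (next j) ≡ nth s vs (suc (toℕ j))
    v-next j = trans (cong (nth s vs) (toℕ-fromℕ< (m%n<n (suc (toℕ j)) n))) (wrap (m≤n⇒m<n∨m≡n (toℕ<n j)))
      where
      wrap : suc (toℕ j) < n ⊎ suc (toℕ j) ≡ n → nth s vs (suc (toℕ j) % n) ≡ nth s vs (suc (toℕ j))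
      wrap (inj₁ j+1<n) = cong (nth s vs) (m<n⇒m%n≡m j+1<n)
      -- At the wrap-around, index 0 yields the first vertex `s`, and index `n` yields the default
      -- value, again `s`.
      wrap (inj₂ j+1≡n) = trans (cong (nth s vs) (trans (cong (_% n) j+1≡n) (n%n≡0 n)))
        (trans (nth-start s∈f χf≡κ p) (sym (trans (cong (nth s vs) (trans j+1≡n (sym length-vs))) (nth-length s vs))))

    steps : ∀ j → v j ∈ₑ e j × v (next j) ∈ₑ e j × χ (e j) ≡ κ
    steps j with vj∈ , vj+1∈ , eq ← nth-steps s∈f χf≡κ p t∈f (in-range j) =
      vj∈ , subst (_∈ₑ e j) (sym (v-next j)) vj+1∈ , eq

-- Searches the functions value by value. A function rebuilt from its values agrees with the
-- original pointwise, hence the assumption that `P` respects `≗`.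
anyFunction? : ∀ m {A : Set} → (∀ {R : A → Set} → Decidable R → Dec (∃ R)) →
  {P : (Fin m → A) → Set} → (∀ {f g} → f ≗ g → P f → P g) → Decidable P → Dec (∃ P)
anyFunction? zero any resp P? = map′ (λ p → _ , p) (λ (f , p) → resp (λ ()) p) (P? λ ())
anyFunction? (suc m) any {P} resp P? = map′
  (λ (x , f , p) → x Vector.∷ f , p)
  (λ (f , p) → f zero , f ∘ suc , resp (λ { zero → refl ; (suc i) → refl }) p)
  (any λ x → anyFunction? m any (λ f≗g → resp (λ { zero → refl ; (suc i) → f≗g i })) (λ f → P? (x Vector.∷ f)))

injective? : ∀ {m} {A : Set} → (∀ (x y : A) → Dec (x ≡ y)) → (f : Fin m → A) → Dec (Injective _≡_ _≡_ f)
injective? _≡?_ f = map′ (λ inj {x} {y} → inj x y) (λ inj x y → inj)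
  (all? λ x → all? λ y → (f x ≡? f y) →-dec (x ≟ y))

surjective? : ∀ {m l} (f : Fin m → Fin l) → Dec (Surjective _≡_ _≡_ f)
surjective? f = map′
  (λ surj y → proj₁ (surj y) , λ { refl → proj₂ (surj y) })
  (λ surj y → proj₁ (surj y) , proj₂ (surj y) refl)
  (all? λ y → any? λ x → f x ≟ y)

injective-resp : ∀ {m} {A : Set} {f g : Fin m → A} → f ≗ g → Injective _≡_ _≡_ f → Injective _≡_ _≡_ g
injective-resp f≗g inj eq = inj (trans (f≗g _) (trans eq (sym (f≗g _))))

surjective-resp : ∀ {m l} {f g : Fin m → Fin l} → f ≗ g → Surjective _≡_ _≡_ f → Surjective _≡_ _≡_ g
surjective-resp f≗g surj y = let x , eq = surj y in x , λ z≡x → trans (sym (f≗g _)) (eq z≡x)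

-- All data of a cycle range over finite sets. Decidability makes the conclusion stable under double
-- negation, so the argument by contradiction yields an actual cycle.
monoHamBergeCycle? : ∀ {n k} .{{_ : NonZero n}} (χ : Edge4 n → Fin k) → Dec (MonoHamBergeCycle n χ)
monoHamBergeCycle? {n} {k} χ =
  anyFunction? n any?
    (λ v≗ (e , κ , (inj , surj) , e-inj , steps) → e , κ , (injective-resp v≗ inj , surjective-resp v≗ surj) , e-inj ,
      λ j → let p , q , r = steps j in subst (_∈ₑ e j) (v≗ j) p , subst (_∈ₑ e j) (v≗ (next j)) q , r)
    λ v → anyFunction? n anyEdge?
      (λ {e} {e′} e≗ (κ , bij , e-inj , steps) → κ , bij , injective-resp e≗ e-inj ,
        λ j → subst (λ f → v j ∈ₑ f × v (next j) ∈ₑ f × χ f ≡ κ) (e≗ j) (steps j))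
      λ e → any? λ κ → (injective? _≟_ v ×-dec surjective? v) ×-dec injective? _≟ₑ_ e ×-dec
        all? λ j → (v j ∈ₑ? e j) ×-dec (v (next j) ∈ₑ? e j) ×-dec (χ (e j) ≟ κ)

theorem3p2 : (n : ℕ) → 85 ≤ n → .{{_ : NonZero n}} →
    (χ : Edge4 n → Fin 3) → MonoHamBergeCycle n χ
theorem3p2 n 85≤n χ = decidable-stable (monoHamBergeCycle? χ) λ none →
  let saturate = λ κ → Berge.saturate χ κ (≤-trans (s≤s (s≤s (s≤s z≤n))) 85≤n) (none ∘ cycle⇒mono χ) in
  -- The goal is now `⊥`, so the doubly negated saturated graphs of the three colours can be
  -- unpacked one after another.
  saturate zero λ S₀ → saturate (suc zero) λ S₁ → saturate (suc (suc zero)) λ S₂ →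
  Rainbow.contradictory 85≤n χ λ { zero → S₀ ; (suc zero) → S₁ ; (suc (suc zero)) → S₂ }
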